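{- Let $N=\{1,\dots,n\}$, let $\mathcal{I}\subseteq2^N$ be the family of independent sets of a matroid on $N$, and let $s=\max\{|X|:X\in\mathcal{I}\}\ge1$. Let $u\colon\mathbb{R}^n\to\mathbb{R}$ be continuously differentiable with $u(\mathbf{0})\ge0$, restricted strongly concave on $\Omega_{2s}$ with parameter $m_{2s}>0$ and restricted smooth on $\Omega_{s,2}$ with parameter $M_{s,2}>0$, and let $f(X)=\max_{\mathrm{supp}(\mathbf{w})\subseteq X}u(\mathbf{w})$ for $X\subseteq N$. Let $X^*\in\arg\max_{X\in\mathcal{I}}f(X)$. If $X$ is the solution obtained by executing $T$ iterations of the semi-oblivious or the non-oblivious local search algorithm (described in the context), then $$f(X)\ge\frac{m_{2s}^2}{M_{s,2}^2}\left(1-\exp\left(-\frac{M_{s,2}T}{s\,m_{2s}}\right)\right)f(X^*).$$ If $X$ is the output returned when the algorithm stops by finding no pair to improve the solution, then $$f(X)\ge\frac{m_{2s}^2}{M_{s,2}^2}f(X^*).$$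
   Context: Notation: $X+a=X\cup\{a\}$, $X-a=X\setminus\{a\}$; $\mathrm{supp}(\mathbf{w})=\{i:\mathbf{w}_i\ne0\}$, $\|\mathbf{w}\|_0=|\mathrm{supp}(\mathbf{w})|$. It is assumed that the maximum defining $f(X)$ is attained for every $X\subseteq N$; $\mathbf{w}^{(X)}$ denotes the maximizer of $u$ over $\{\mathbf{w}:\mathrm{supp}(\mathbf{w})\subseteq X\}$ (unique by restricted strong concavity for the sets $X\in\mathcal{I}$ used by the algorithms). Domains: $\Omega_{r}=\{(\mathbf{x},\mathbf{y})\in\mathbb{R}^n\times\mathbb{R}^n: \|\mathbf{x}\|_0\le r,\ \|\mathbf{y}\|_0\le r,\ \|\mathbf{x}-\mathbf{y}\|_0\le r\}$ and $\Omega_{r,t}=\{(\mathbf{x},\mathbf{y}): \|\mathbf{x}\|_0\le r,\ \|\mathbf{y}\|_0\le r,\ \|\mathbf{x}-\mathbf{y}\|_0\le t\}$. $u$ is restricted strongly concave on $\Omega$ with parameter $m_\Omega$ if $u(\mathbf{y})-u(\mathbf{x})-\langle\nabla u(\mathbf{x}),\mathbf{y}-\mathbf{x}\rangle\le-\frac{m_\Omega}{2}\|\mathbf{y}-\mathbf{x}\|_2^2$ on $\Omega$, and restricted smooth on $\Omega$ with parameter $M_\Omega$ if $u(\mathbf{y})-u(\mathbf{x})-\langle\nabla u(\mathbf{x}),\mathbf{y}-\mathbf{x}\rangle\ge-\frac{M_\Omega}{2}\|\mathbf{y}-\mathbf{x}\|_2^2$ on $\Omega$. Both algorithms start with $X=\emptyset$,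 add arbitrary elements until $X$ is maximal in $\mathcal{I}$, and then perform up to $T$ iterations, returning $X$ at the end (ties broken arbitrarily; if no admissible pair exists, stop). Semi-oblivious iteration: for each $x'\in N\setminus X$ for which some $x\in X$ satisfies $X-x+x'\in\mathcal{I}$, let $\phi_X(x')\in\arg\min\{(\mathbf{w}^{(X)})_x^2: x\in X,\ X-x+x'\in\mathcal{I}\}$. Choose $x'$ maximizing $f(X-\phi_X(x')+x')-f(X)$ over such $x'$, and put $x=\phi_X(x')$. If $f(X-x+x')-f(X)>0$, replace $X$ by $X-x+x'$; otherwise stop and return $X$. Non-oblivious iteration: choose $(x,x')$, $x\in X$, $x'\in N\setminus X$, $X-x+x'\in\mathcal{I}$, maximizing $g(x,x')=\frac{1}{2M_{s,2}}(\nabla u(\mathbf{w}^{(X)}))_{x'}^2-\frac{M_{s,2}}{2}(\mathbf{w}^{(X)})_x^2$. If $g(x,x')>0$, replace $X$ by $X-x+x'$; otherwise stop and return $X$. -}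

module Defs where

open import Algebra.Bundles using (CommutativeRing; Semiring)
open import Algebra.Structures using (IsCommutativeRing)
import Algebra.Definitions.RawSemiring as RawSemiringDefs
import Algebra.Properties.Ring as RingProperties
open import Data.Bool.Base using (not)
open import Data.Empty using (⊥-elim)
open import Data.Fin.Base using (Fin)
open import Data.Fin.Subset using (Subset; _∈_; _∉_; _⊆_; _∪_; ⁅_⁆; ∣_∣; ⊥)
  renaming (_-_ to _∖_)
open import Data.Nat.Base as ℕ using (ℕ; zero; suc; _!)
import Data.Nat.Properties as ℕₚ
open import Data.Product.Base using (∃; ∃₂; _×_; _,_; proj₁; proj₂; uncurry)
open import Data.Sum.Base using (_⊎_; inj₁; inj₂; [_,_]′)
open import Data.Vec.Base as Vec using (Vec; lookup; zipWith; replicate)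
open import Function.Base using (const)
open import Relation.Binary.PropositionalEquality
  using (_≡_; _≢_; refl; sym; trans; cong; cong₂; subst; subst₂)
open import Relation.Binary.Structures using (IsDecTotalOrder)
open import Relation.Nullary using (¬_; yes; no; does)
import Relation.Unary as U

-- The inverse is total; its value at 0# is unspecified.  The order is decidable,
-- as it is classically for ℝ, so that supports are subsets in the sense of
-- Data.Fin.Subset.
record OrderedField : Set₁ where
  infix  4 _≤_
  infixl 6 _+_
  infixl 7 _*_
  infix  8 -_
  infix  9 _⁻¹
  field
    ℝ                 : Set
    _+_ _*_           : ℝ → ℝ → ℝ
    -_ _⁻¹            : ℝ → ℝ
    0# 1#             : ℝ
    _≤_               : ℝ → ℝ → Set
    isCommutativeRing : IsCommutativeRing _≡_ _+_ _*_ -_ 0# 1#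
    0≢1               : 0# ≢ 1#
    ⁻¹-inverseʳ       : ∀ {x} → x ≢ 0# → x * x ⁻¹ ≡ 1#
    isDecTotalOrder   : IsDecTotalOrder _≡_ _≤_
    +-monoˡ-≤         : ∀ z {x y} → x ≤ y → x + z ≤ y + z
    *-nonNeg          : ∀ {x y} → 0# ≤ x → 0# ≤ y → 0# ≤ x * y

  commutativeRing : CommutativeRing _ _
  commutativeRing = record { isCommutativeRing = isCommutativeRing }

  open CommutativeRing commutativeRing public
    using (+-comm; +-assoc; +-identityˡ; +-identityʳ; -‿inverseˡ; -‿inverseʳ;
           *-comm; *-assoc; *-identityˡ; *-identityʳ; distribˡ; distribʳ;
           zeroˡ; zeroʳ; ring; semiring)
  open IsDecTotalOrder isDecTotalOrder public
    using (_≟_; _≤?_; total)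
    renaming (refl to ≤-refl; reflexive to ≤-reflexive;
              trans to ≤-trans; antisym to ≤-antisym)
  open RawSemiringDefs (Semiring.rawSemiring semiring) public using (_^_) renaming (_×_ to _·_)

  infix  4 _<_
  infixl 6 _-_
  infixl 7 _/_

  _<_ : ℝ → ℝ → Set
  x < y = x ≤ y × x ≢ y

  _-_ _/_ : ℝ → ℝ → ℝ
  x - y = x + (- y)
  x / y = x * y ⁻¹

  fromℕ : ℕ → ℝ
  fromℕ k = k · 1#

  2# : ℝ
  2# = fromℕ 2

  abs : ℝ → ℝ
  abs x = [ const x , const (- x) ]′ (total 0# x)

  IsCauchy : (ℕ → ℝ) → Set
  IsCauchy a = ∀ ε → 0# < ε →
    ∃ λ N → ∀ i j → N ℕ.≤ i → N ℕ.≤ j → abs (a i - a j) < ε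

  _ConvergesTo_ : (ℕ → ℝ) → ℝ → Set
  a ConvergesTo l = ∀ ε → 0# < ε →
    ∃ λ N → ∀ i → N ℕ.≤ i → abs (a i - l) < ε

-- The Archimedean Cauchy-complete ordered field, unique up to isomorphism.
record Reals : Set₁ where
  field
    orderedField : OrderedField
  open OrderedField orderedField public
  field
    archimedean : ∀ x → ∃ λ k → x ≤ fromℕ k
    complete    : ∀ a → IsCauchy a → ∃ λ l → a ConvergesTo l

module Exponential (R : Reals) where
  open Reals R

  expTerm : ℝ → ℕ → ℝ
  expTerm x k = x ^ k / fromℕ (k !)

  expSum : ℝ → ℕ → ℝ
  expSum x zero    = 0#
  expSum x (suc k) = expSum x k + expTerm x k

  private
    open RingProperties ring
      using (-‿distribˡ-*; -‿distribʳ-*; -‿involutive; -‿+-comm; -0#≈0#)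

    +-mono-≤ : ∀ {a b c d} → a ≤ b → c ≤ d → a + c ≤ b + d
    +-mono-≤ {a} {b} {c} {d} p q =
      ≤-trans (+-monoˡ-≤ c p)
        (subst₂ _≤_ (+-comm c b) (+-comm d b) (+-monoˡ-≤ b q))

    0≤+ : ∀ {a b} → 0# ≤ a → 0# ≤ b → 0# ≤ a + b
    0≤+ {a} {b} p q = subst (_≤ a + b) (+-identityˡ 0#) (+-mono-≤ p q)

    x-y+y : ∀ x y → (x - y) + y ≡ x
    x-y+y x y = trans (+-assoc x (- y) y)
      (trans (cong (x +_) (-‿inverseˡ y)) (+-identityʳ x))

    x+y-y : ∀ x y → (x + y) - y ≡ x
    x+y-y x y = trans (+-assoc x y (- y))
      (trans (cong (x +_) (-‿inverseʳ y)) (+-identityʳ x))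

    interchange : ∀ p q r s → (p + q) + (r + s) ≡ (p + r) + (q + s)
    interchange p q r s = trans (+-assoc p q (r + s))
      (trans (cong (p +_) (trans (sym (+-assoc q r s))
        (trans (cong (_+ s) (+-comm q r)) (+-assoc r q s))))
        (sym (+-assoc p r (q + s))))

    ≤⇒0≤- : ∀ {x y} → x ≤ y → 0# ≤ y - x
    ≤⇒0≤- {x} {y} p = subst (_≤ y - x) (-‿inverseʳ x) (+-monoˡ-≤ (- x) p)

    0≤-⇒≤ : ∀ {x y} → 0# ≤ y - x → x ≤ y
    0≤-⇒≤ {x} {y} p = subst₂ _≤_ (+-identityˡ x) (x-y+y y x) (+-monoˡ-≤ x p)

    neg-mono : ∀ {x y} → x ≤ y → - y ≤ - x
    neg-mono {x} {y} p = 0≤-⇒≤ (subst (0# ≤_) eq (≤⇒0≤- p))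
      where
      eq : y - x ≡ - x - - y
      eq = trans (+-comm y (- x)) (cong (- x +_) (sym (-‿involutive y)))

    *-monoˡ : ∀ {x y} z → 0# ≤ z → x ≤ y → x * z ≤ y * z
    *-monoˡ {x} {y} z 0≤z p = 0≤-⇒≤ (subst (0# ≤_) eq (*-nonNeg (≤⇒0≤- p) 0≤z))
      where
      eq : (y - x) * z ≡ y * z - x * z
      eq = trans (distribʳ z y (- x)) (cong (y * z +_) (sym (-‿distribˡ-* x z)))

    *-monoʳ : ∀ {x y} z → 0# ≤ z → x ≤ y → z * x ≤ z * y
    *-monoʳ {x} {y} z 0≤z p =
      subst₂ _≤_ (*-comm x z) (*-comm y z) (*-monoˡ z 0≤z p)

    ≤⇒≯ : ∀ {x y} → x ≤ y → ¬ (y < x)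
    ≤⇒≯ p (q , y≢x) = y≢x (≤-antisym q p)

    ≰⇒> : ∀ {x y} → ¬ (x ≤ y) → y < x
    ≰⇒> {x} {y} ¬p with total x y
    ... | inj₁ p = ⊥-elim (¬p p)
    ... | inj₂ q = q , λ eq → ¬p (≤-reflexive (sym eq))

    ≤-<-trans : ∀ {x y z} → x ≤ y → y < z → x < z
    ≤-<-trans p (q , y≢z) =
      ≤-trans p q , λ { refl → y≢z (≤-antisym q p) }

    0≤-neg : ∀ {x} → x ≤ 0# → 0# ≤ - x
    0≤-neg p = subst (_≤ _) -0#≈0# (neg-mono p)

    0≤1 : 0# ≤ 1#
    0≤1 with total 0# 1#
    ... | inj₁ p = p
    ... | inj₂ q = subst (0# ≤_) eq (*-nonNeg (0≤-neg q) (0≤-neg q))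
      where
      eq : - 1# * - 1# ≡ 1#
      eq = trans (sym (-‿distribˡ-* 1# (- 1#)))
             (trans (cong -_ (*-identityˡ (- 1#))) (-‿involutive 1#))

    0≤fromℕ : ∀ k → 0# ≤ fromℕ k
    0≤fromℕ zero    = ≤-refl
    0≤fromℕ (suc k) = 0≤+ 0≤1 (0≤fromℕ k)

    1≤fromℕ : ∀ k → 1# ≤ fromℕ (suc k)
    1≤fromℕ k = subst (_≤ fromℕ (suc k)) (+-identityʳ 1#)
                  (+-mono-≤ ≤-refl (0≤fromℕ k))

    fromℕ-+ : ∀ i j → fromℕ (i ℕ.+ j) ≡ fromℕ i + fromℕ j
    fromℕ-+ zero    j = sym (+-identityˡ _)
    fromℕ-+ (suc i) j = trans (cong (1# +_) (fromℕ-+ i j)) (sym (+-assoc _ _ _))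

    fromℕ-* : ∀ i j → fromℕ (i ℕ.* j) ≡ fromℕ i * fromℕ j
    fromℕ-* zero    j = sym (zeroˡ _)
    fromℕ-* (suc i) j = trans (fromℕ-+ j (i ℕ.* j))
      (trans (cong₂ _+_ (sym (*-identityˡ _)) (fromℕ-* i j))
             (sym (distribʳ _ _ _)))

    fromℕ-mono : ∀ {i j} → i ℕ.≤ j → fromℕ i ≤ fromℕ j
    fromℕ-mono {j = j} ℕ.z≤n = 0≤fromℕ j
    fromℕ-mono (ℕ.s≤s p)     = +-mono-≤ ≤-refl (fromℕ-mono p)

    fromℕ≢0 : ∀ k → .{{ℕ.NonZero k}} → fromℕ k ≢ 0#
    fromℕ≢0 (suc k) eq =
      0≢1 (≤-antisym 0≤1 (subst (1# ≤_) eq (1≤fromℕ k)))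

    *-cancelʳ : ∀ {x y z} → z ≢ 0# → x * z ≡ y * z → x ≡ y
    *-cancelʳ {x} {y} {z} z≢0 eq = trans (sym (lem x)) (trans (cong (_* z ⁻¹) eq) (lem y))
      where
      lem : ∀ a → (a * z) * z ⁻¹ ≡ a
      lem a = trans (*-assoc a z (z ⁻¹))
                (trans (cong (a *_) (⁻¹-inverseʳ z≢0)) (*-identityʳ a))

    /-cancel : ∀ x {z} → z ≢ 0# → (x / z) * z ≡ x
    /-cancel x {z} z≢0 = trans (*-assoc x (z ⁻¹) z)
      (trans (cong (x *_) (trans (*-comm (z ⁻¹) z) (⁻¹-inverseʳ z≢0)))
             (*-identityʳ x))

    *-cancelʳ-≤ : ∀ {x y z} → 0# < z → x * z ≤ y * z → x ≤ y
    *-cancelʳ-≤ {x} {y} {z} (0≤z , 0≢z) p with x ≤? y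
    ... | yes q = q
    ... | no ¬q with ≰⇒> ¬q
    ...   | y≤x , y≢x = ⊥-elim (y≢x (*-cancelʳ (λ e → 0≢z (sym e))
                          (≤-antisym (*-monoˡ z 0≤z y≤x) p)))

    *-swap : ∀ a b c → (a * b) * c ≡ (a * c) * b
    *-swap a b c = trans (*-assoc a b c)
      (trans (cong (a *_) (*-comm b c)) (sym (*-assoc a c b)))

    k!≢0 : ∀ k → fromℕ (k !) ≢ 0#
    k!≢0 k = fromℕ≢0 (k !) {{k ℕₚ.!≢0}}

    expTerm-suc : ∀ x k → expTerm x (suc k) * fromℕ (suc k) ≡ expTerm x k * x
    expTerm-suc x k = *-cancelʳ (k!≢0 k)
      (trans (*-assoc _ _ _)
      (trans (cong (expTerm x (suc k) *_) (sym (fromℕ-* (suc k) (k !))))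
      (trans (/-cancel (x ^ suc k) (k!≢0 (suc k)))
      (trans (*-comm x (x ^ k))
      (trans (cong (_* x) (sym (/-cancel (x ^ k) (k!≢0 k))))
             (*-swap _ _ _))))))

    0<suc : ∀ k → 0# < fromℕ (suc k)
    0<suc k = 0≤fromℕ (suc k) , λ e → fromℕ≢0 (suc k) (sym e)

    -- The terms at  x  are dominated by those at  y  whenever -y ≤ x ≤ y.
    module _ {x y : ℝ} (-y≤x : - y ≤ x) (x≤y : x ≤ y) (0≤y : 0# ≤ y) where

      t s : ℕ → ℝ
      t = expTerm y
      s = expTerm x

      0≤t : ∀ k → 0# ≤ t k
      0≤t zero = *-cancelʳ-≤ (0<suc 0) (subst₂ _≤_ (sym (zeroˡ _))
                   (sym (/-cancel 1# (k!≢0 0))) 0≤1)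
      0≤t (suc k) = *-cancelʳ-≤ (0<suc k)
        (subst₂ _≤_ (sym (zeroˡ _)) (sym (expTerm-suc y k)) (*-nonNeg (0≤t k) 0≤y))

      *-bound : ∀ {a b c d} → - b ≤ a → a ≤ b → - d ≤ c → c ≤ d → a * c ≤ b * d
      *-bound {a} {b} {c} {d} p q p′ q′ = 0≤-⇒≤ (half (subst (0# ≤_) eq
        (0≤+ (*-nonNeg (≤⇒0≤- q) (≤+ p′)) (*-nonNeg (≤+ p) (≤⇒0≤- q′)))))
        where
        ≤+ : ∀ {u v} → - v ≤ u → 0# ≤ v + u
        ≤+ {u} {v} h = subst (0# ≤_) (trans (cong (u +_) (-‿involutive v)) (+-comm u v))
                         (≤⇒0≤- h)
        half : ∀ {z} → 0# ≤ z + z → 0# ≤ z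
        half {z} h with total 0# z
        ... | inj₁ r = r
        ... | inj₂ r = ≤-trans h (subst (z + z ≤_) (+-identityʳ z) (+-mono-≤ ≤-refl r))
        z = b * d - a * c
        e₁ : (b - a) * (d + c) ≡ z + (b * c - a * d)
        e₁ = trans (distribʳ (d + c) b (- a))
          (trans (cong₂ _+_ (distribˡ b d c)
                   (trans (sym (-‿distribˡ-* a (d + c)))
                   (trans (cong -_ (trans (distribˡ a d c) (+-comm _ _)))
                          (sym (-‿+-comm (a * c) (a * d))))))
                 (interchange (b * d) (b * c) (- (a * c)) (- (a * d))))
        e₂ : (b + a) * (d - c) ≡ z - (b * c - a * d)
        e₂ = trans (distribʳ (d - c) b a)
          (trans (cong₂ _+_ (exp₁ b) (trans (exp₁ a) (+-comm _ _)))
          (trans (interchange (b * d) (- (b * c)) (- (a * c)) (a * d))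
                 (cong (z +_) (trans (cong (- (b * c) +_) (sym (-‿involutive (a * d))))
                                     (-‿+-comm (b * c) (- (a * d)))))))
          where
          exp₁ : ∀ v → v * (d - c) ≡ v * d - v * c
          exp₁ v = trans (distribˡ v d (- c)) (cong (v * d +_) (sym (-‿distribʳ-* v c)))
        eq : (b - a) * (d + c) + (b + a) * (d - c) ≡ z + z
        eq = trans (cong₂ _+_ e₁ e₂)
          (trans (+-assoc z w (z - w))
          (cong (z +_) (trans (+-comm w (z - w)) (x-y+y z w))))
          where w = b * c - a * d

      *-bound′ : ∀ {a b c d} → - b ≤ a → a ≤ b → - d ≤ c → c ≤ d → - (b * d) ≤ a * c
      *-bound′ {a} {b} {c} {d} p q p′ q′ =
        subst (- (b * d) ≤_)
          (trans (cong -_ (sym (-‿distribˡ-* a c))) (-‿involutive (a * c)))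
          (neg-mono (*-bound (neg-mono q) (subst (- a ≤_) (-‿involutive b) (neg-mono p)) p′ q′))

      s≤t  : ∀ k → s k ≤ t k
      -t≤s : ∀ k → - t k ≤ s k
      s≤t zero     = ≤-refl
      s≤t (suc k)  = *-cancelʳ-≤ (0<suc k)
        (subst₂ _≤_ (sym (expTerm-suc x k)) (sym (expTerm-suc y k))
          (*-bound (-t≤s k) (s≤t k) -y≤x x≤y))
      -t≤s zero    = ≤-trans (subst (- t 0 ≤_) -0#≈0# (neg-mono (0≤t 0))) (0≤t 0)
      -t≤s (suc k) = *-cancelʳ-≤ (0<suc k)
        (subst₂ _≤_
          (trans (cong -_ (sym (expTerm-suc y k))) (-‿distribˡ-* (t (suc k)) _))
          (sym (expTerm-suc x k))
          (*-bound′ (-t≤s k) (s≤t k) -y≤x x≤y))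

      K : ℕ
      K = proj₁ (archimedean (y + y))

      t-halves : ∀ k → K ℕ.≤ k → t (suc k) + t (suc k) ≤ t k
      t-halves k K≤k = *-cancelʳ-≤ (0<suc k) (subst (_≤ t k * fromℕ (suc k)) eq
        (*-monoʳ (t k) (0≤t k)
          (≤-trans (proj₂ (archimedean (y + y)))
                   (fromℕ-mono (ℕₚ.≤-trans K≤k (ℕₚ.n≤1+n k))))))
        where
        eq : t k * (y + y) ≡ (t (suc k) + t (suc k)) * fromℕ (suc k)
        eq = trans (distribˡ (t k) y y)
          (trans (cong₂ _+_ (sym (expTerm-suc y k)) (sym (expTerm-suc y k)))
                 (sym (distribʳ _ _ _)))

      t-decay : ∀ j → t (j ℕ.+ K) * fromℕ (suc j) ≤ t K
      t-decay zero    = ≤-reflexive (trans (cong (t K *_) (+-identityʳ 1#)) (*-identityʳ _))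
      t-decay (suc j) = ≤-trans (≤-trans step₁ (≤-reflexive eq))
        (≤-trans (*-monoˡ _ (0≤fromℕ (suc j)) (t-halves (j ℕ.+ K) (ℕₚ.m≤n+m K j)))
                 (t-decay j))
        where
        t′ = t (suc j ℕ.+ K)
        step₁ : t′ * fromℕ (suc (suc j)) ≤ t′ * (fromℕ (suc j) + fromℕ (suc j))
        step₁ = *-monoʳ t′ (0≤t (suc j ℕ.+ K)) (+-mono-≤ (1≤fromℕ j) ≤-refl)
        eq : t′ * (fromℕ (suc j) + fromℕ (suc j)) ≡ (t′ + t′) * fromℕ (suc j)
        eq = trans (distribˡ _ _ _) (sym (distribʳ _ _ _))

      S B : ℕ → ℝ
      S = expSum x
      B k = t k + t k

      upper : ∀ d k → K ℕ.≤ k → S (d ℕ.+ k) + B (d ℕ.+ k) ≤ S k + B k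
      upper zero    k K≤k = ≤-refl
      upper (suc d) k K≤k = ≤-trans
        (≤-trans (≤-reflexive (+-assoc _ _ _))
          (+-mono-≤ ≤-refl (+-mono-≤ (s≤t i) (t-halves i (ℕₚ.≤-trans K≤k (ℕₚ.m≤n+m k d))))))
        (upper d k K≤k)
        where i = d ℕ.+ k

      lower : ∀ d k → K ℕ.≤ k → S k - B k ≤ S (d ℕ.+ k) - B (d ℕ.+ k)
      lower zero    k K≤k = ≤-refl
      lower (suc d) k K≤k = ≤-trans (lower d k K≤k)
        (≤-trans (+-mono-≤ ≤-refl (≤-trans (≤-reflexive (sym (-‿+-comm (t i) (t i))))
            (+-mono-≤ (-t≤s i) (neg-mono (t-halves i (ℕₚ.≤-trans K≤k (ℕₚ.m≤n+m k d)))))))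
          (≤-reflexive (sym (+-assoc _ _ _))))
        where i = d ℕ.+ k

      0≤B : ∀ k → 0# ≤ B k
      0≤B k = 0≤+ (0≤t k) (0≤t k)

      within : ∀ k i → K ℕ.≤ k → k ℕ.≤ i → S k - B k ≤ S i × S i ≤ S k + B k
      within k i K≤k k≤i rewrite sym (ℕₚ.m∸n+n≡m k≤i) =
          ≤-trans (lower d k K≤k)
            (subst (S (d ℕ.+ k) - B (d ℕ.+ k) ≤_) (+-identityʳ _)
              (+-mono-≤ ≤-refl (subst (- B (d ℕ.+ k) ≤_) -0#≈0# (neg-mono (0≤B (d ℕ.+ k))))))
        , ≤-trans (subst (_≤ S (d ℕ.+ k) + B (d ℕ.+ k)) (+-identityʳ _)
                    (+-mono-≤ ≤-refl (0≤B (d ℕ.+ k))))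
            (upper d k K≤k)
        where d = i ℕ.∸ k

      abs-≤ : ∀ {a b} → a ≤ b → - a ≤ b → abs a ≤ b
      abs-≤ {a} p q with total 0# a
      ... | inj₁ _ = p
      ... | inj₂ _ = q

      diff-≤ : ∀ {a b c d} → a ≤ c + d → c - d ≤ b → a - b ≤ d + d
      diff-≤ {a} {b} {c} {d} p q = ≤-trans (+-mono-≤ p (neg-mono q)) (≤-reflexive eq)
        where
        eq : (c + d) + - (c - d) ≡ d + d
        eq = trans (cong₂ _+_ (+-comm c d)
                     (trans (sym (-‿+-comm c (- d))) (cong (- c +_) (-‿involutive d))))
             (trans (+-assoc d c (- c + d))
             (cong (d +_) (trans (sym (+-assoc c (- c) d))
               (trans (cong (_+ d) (-‿inverseʳ c)) (+-identityˡ d)))))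

      cauchy : IsCauchy (expSum x)
      cauchy ε (0≤ε , 0≢ε) = N , λ i j N≤i N≤j →
        let (lᵢ , uᵢ) = within N i (ℕₚ.m≤n+m K J) N≤i
            (lⱼ , uⱼ) = within N j (ℕₚ.m≤n+m K J) N≤j
        in ≤-<-trans
             (abs-≤ (diff-≤ uᵢ lⱼ)
               (subst (_≤ B N + B N)
                 (trans (+-comm (S j) (- S i))
                 (trans (cong (- S i +_) (sym (-‿involutive (S j))))
                        (-‿+-comm (S i) (- S j))))
                 (diff-≤ uⱼ lᵢ)))
             small
        where
        C = B K + B K
        J = suc (proj₁ (archimedean (C / ε)))
        N = J ℕ.+ K
        ε≢0 : ε ≢ 0#
        ε≢0 e = 0≢ε (sym e)
        C≤Jε : C ≤ fromℕ J * ε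
        C≤Jε = subst (_≤ fromℕ J * ε) (/-cancel C ε≢0) (*-monoˡ ε 0≤ε
          (≤-trans (proj₂ (archimedean (C / ε))) (fromℕ-mono (ℕₚ.n≤1+n (proj₁ (archimedean (C / ε)))))))
        quad : ∀ a z → ((a + a) + (a + a)) * z ≡ (a * z + a * z) + (a * z + a * z)
        quad a z = trans (distribʳ z (a + a) (a + a))
                     (cong₂ _+_ (distribʳ z a a) (distribʳ z a a))
        decay : (B N + B N) * fromℕ (suc J) ≤ C
        decay = ≤-trans (≤-reflexive (quad (t N) (fromℕ (suc J))))
          (+-mono-≤ (+-mono-≤ (t-decay J) (t-decay J)) (+-mono-≤ (t-decay J) (t-decay J)))
        small : B N + B N < ε
        small with ε ≤? B N + B N
        ... | no ¬p = ≰⇒> ¬p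
        ... | yes p = ⊥-elim (ε≢0 (≤-antisym (0≤-⇒≤ 0≤-ε) 0≤ε))
          where
          [1+J]ε≤Jε : ε + fromℕ J * ε ≤ fromℕ J * ε
          [1+J]ε≤Jε = ≤-trans (≤-reflexive
              (trans (cong (_+ fromℕ J * ε) (sym (*-identityˡ ε))) (sym (distribʳ ε 1# (fromℕ J)))))
            (≤-trans (≤-reflexive (*-comm _ ε))
            (≤-trans (*-monoˡ _ (0≤fromℕ (suc J)) p) (≤-trans decay C≤Jε)))
          0≤-ε : 0# ≤ 0# - ε
          0≤-ε = ≤⇒0≤- (subst₂ _≤_ (x+y-y ε (fromℕ J * ε)) (-‿inverseʳ _)
                   (+-monoˡ-≤ (- (fromℕ J * ε)) [1+J]ε≤Jε))

  expSum-cauchy : ∀ x → IsCauchy (expSum x)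
  expSum-cauchy x with total 0# x
  ... | inj₁ 0≤x = cauchy (≤-trans (subst (- x ≤_) -0#≈0# (neg-mono 0≤x)) 0≤x) ≤-refl 0≤x
  ... | inj₂ x≤0 = cauchy (≤-reflexive (-‿involutive x)) (≤-trans x≤0 (0≤-neg x≤0)) (0≤-neg x≤0)

  exp : ℝ → ℝ
  exp x = proj₁ (complete (expSum x) (expSum-cauchy x))

  expSum-converges : ∀ x → expSum x ConvergesTo exp x
  expSum-converges x = proj₂ (complete (expSum x) (expSum-cauchy x))

private
  variable
    n : ℕ

swap : Subset n → Fin n → Fin n → Subset n
swap X x x′ = (X ∖ x) ∪ ⁅ x′ ⁆

record Matroid (n : ℕ) : Set₁ where
  field
    Indep        : Subset n → Set
    indep?       : U.Decidable Indep
    indep-⊥      : Indep ⊥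
    hereditary   : ∀ {X Y} → X ⊆ Y → Indep Y → Indep X
    augmentation : ∀ {X Y} → Indep X → Indep Y → ∣ X ∣ ℕ.< ∣ Y ∣ →
                   ∃ λ y → y ∈ Y × y ∉ X × Indep (X ∪ ⁅ y ⁆)

  IsRank : ℕ → Set
  IsRank s = (∃ λ X → Indep X × ∣ X ∣ ≡ s) × (∀ X → Indep X → ∣ X ∣ ℕ.≤ s)

module Analysis (R : Reals) where
  open Reals R

  infixl 6 _-ᵥ_

  ℝ^ : ℕ → Set
  ℝ^ n = Vec ℝ n

  𝟎 : ℝ^ n
  𝟎 = replicate _ 0#

  _-ᵥ_ : ℝ^ n → ℝ^ n → ℝ^ n
  _-ᵥ_ = zipWith _-_

  ⟨_,_⟩ : ℝ^ n → ℝ^ n → ℝ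
  ⟨ x , y ⟩ = Vec.foldr _ _+_ 0# (zipWith _*_ x y)

  ‖_‖² : ℝ^ n → ℝ
  ‖ x ‖² = ⟨ x , x ⟩

  supp : ℝ^ n → Subset n
  supp = Vec.map (λ a → not (does (a ≟ 0#)))

  ‖_‖₀ : ℝ^ n → ℕ
  ‖ x ‖₀ = ∣ supp x ∣

  IsArgMax : {A : Set} → (A → ℝ) → (A → Set) → A → Set
  IsArgMax h P a = P a × (∀ b → P b → h b ≤ h a)

  IsArgMin : {A : Set} → (A → ℝ) → (A → Set) → A → Set
  IsArgMin h P a = P a × (∀ b → P b → h a ≤ h b)

  linearizationError : (ℝ^ n → ℝ) → (ℝ^ n → ℝ^ n) → ℝ^ n → ℝ^ n → ℝ
  linearizationError u ∇u x y = (u y - u x) - ⟨ ∇u x , y -ᵥ x ⟩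

  -- Fréchet differentiability, with the defining inequality
  -- |error| ≤ ε‖y - x‖ squared on both sides to avoid square roots.
  IsGradient : (ℝ^ n → ℝ) → (ℝ^ n → ℝ^ n) → Set
  IsGradient u ∇u = ∀ x ε → 0# < ε → ∃ λ δ → 0# < δ ×
    (∀ y → ‖ y -ᵥ x ‖² < δ →
      linearizationError u ∇u x y ^ 2 ≤ ε * ‖ y -ᵥ x ‖²)

  IsContinuous : (ℝ^ n → ℝ^ n) → Set
  IsContinuous v = ∀ x ε → 0# < ε → ∃ λ δ → 0# < δ ×
    (∀ y → ‖ y -ᵥ x ‖² < δ → ‖ v y -ᵥ v x ‖² < ε)

  IsC¹WithGradient : (ℝ^ n → ℝ) → (ℝ^ n → ℝ^ n) → Set
  IsC¹WithGradient u ∇u = IsGradient u ∇u × IsContinuous ∇u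

  Ω₂ : ℕ → ℕ → ℝ^ n → ℝ^ n → Set
  Ω₂ r t x y = ‖ x ‖₀ ℕ.≤ r × ‖ y ‖₀ ℕ.≤ r × ‖ x -ᵥ y ‖₀ ℕ.≤ t

  Ω₁ : ℕ → ℝ^ n → ℝ^ n → Set
  Ω₁ r = Ω₂ r r

  RestrictedStronglyConcave : (ℝ^ n → ℝ) → (ℝ^ n → ℝ^ n) →
                              (ℝ^ n → ℝ^ n → Set) → ℝ → Set
  RestrictedStronglyConcave u ∇u Ω m = ∀ x y → Ω x y →
    linearizationError u ∇u x y ≤ - (m / 2#) * ‖ y -ᵥ x ‖²

  RestrictedSmooth : (ℝ^ n → ℝ) → (ℝ^ n → ℝ^ n) →
                     (ℝ^ n → ℝ^ n → Set) → ℝ → Set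
  RestrictedSmooth u ∇u Ω M = ∀ x y → Ω x y →
    - (M / 2#) * ‖ y -ᵥ x ‖² ≤ linearizationError u ∇u x y

  IsMaximizer : (ℝ^ n → ℝ) → Subset n → ℝ^ n → Set
  IsMaximizer u X = IsArgMax u (λ w → supp w ⊆ X)

  MaximaAttained : (ℝ^ n → ℝ) → Set
  MaximaAttained u = ∀ X → ∃ (IsMaximizer u X)

  module Maxima {u : ℝ^ n → ℝ} (attained : MaximaAttained u) where

    -- A selected maximizer; for the X used below it is the only one, by
    -- restricted strong concavity.
    𝐰 : Subset n → ℝ^ n
    𝐰 X = proj₁ (attained X)

    f : Subset n → ℝ
    f X = u (𝐰 X)

-- How a run ended: all iterations were used, or the algorithm stopped
-- because it found no improving pair.
data Ending : Set where
  exhausted noImprovement : Ending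

module LocalSearch (R : Reals) {n : ℕ} (𝓜 : Matroid n) where
  open Reals R
  open Analysis R
  open Matroid 𝓜

  Swappable : Subset n → Fin n → Fin n → Set
  Swappable X x x′ = x ∈ X × x′ ∉ X × Indep (swap X x x′)

  data Grown : Subset n → Set where
    empty : Grown ⊥
    add   : ∀ {X} a → Grown X → a ∉ X → Indep (X ∪ ⁅ a ⁆) → Grown (X ∪ ⁅ a ⁆)

  Initial : Subset n → Set
  Initial X = Grown X × (∀ a → a ∉ X → ¬ Indep (X ∪ ⁅ a ⁆))

  -- Choice X x x′  holds if (x , x′) is a pair the algorithm may select at X
  -- (for some way of breaking ties); the swap is made if its gain is positive.
  record Rule : Set₁ where
    field
      Choice : Subset n → Fin n → Fin n → Set
      gain   : Subset n → Fin n → Fin n → ℝ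

    Stops : Subset n → Set
    Stops X = (∀ x x′ → ¬ Swappable X x x′)
            ⊎ (∃₂ λ x x′ → Choice X x x′ × ¬ (0# < gain X x x′))

    data Run : ℕ → Subset n → Subset n → Ending → Set where
      done : ∀ {X} → Run zero X X exhausted
      stop : ∀ {T X} → Stops X → Run (suc T) X X noImprovement
      step : ∀ {T X x x′ Y e} → Choice X x x′ → 0# < gain X x x′ →
             Run T (swap X x x′) Y e → Run (suc T) X Y e

    Output : ℕ → Subset n → Ending → Set
    Output T X e = ∃ λ X₀ → Initial X₀ × Run T X₀ X e

  module _ {u : ℝ^ n → ℝ} (attained : MaximaAttained u) where
    open Maxima attained

    Addable : Subset n → Fin n → Set
    Addable X x′ = ∃ λ x → Swappable X x x′

    -- The values of φ outside  Addable X  are irrelevant.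
    IsRemoval : Subset n → (Fin n → Fin n) → Set
    IsRemoval X φ = ∀ x′ → Addable X x′ →
      IsArgMin (λ x → lookup (𝐰 X) x ^ 2) (λ x → Swappable X x x′) (φ x′)

    semiOblivious : Rule
    semiOblivious = record
      { Choice = λ X x x′ → ∃ λ φ → IsRemoval X φ
               × IsArgMax (λ z′ → f (swap X (φ z′) z′) - f X) (Addable X) x′
               × x ≡ φ x′
      ; gain   = λ X x x′ → f (swap X x x′) - f X
      }

    nonOblivious : (ℝ^ n → ℝ^ n) → ℝ → Rule
    nonOblivious ∇u M = record
      { Choice = λ X x x′ → IsArgMax (uncurry (g X)) (uncurry (Swappable X)) (x , x′)
      ; gain   = g
      }
      where
      g : Subset n → Fin n → Fin n → ℝ
      g X x x′ = 1# / (2# * M) * lookup (∇u (𝐰 X)) x′ ^ 2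
               - M / 2# * lookup (𝐰 X) x ^ 2

    data IsLocalSearch (∇u : ℝ^ n → ℝ^ n) (M : ℝ) : Rule → Set₁ where
      isSemiOblivious : IsLocalSearch ∇u M semiOblivious
      isNonOblivious  : IsLocalSearch ∇u M (nonOblivious ∇u M)

{-# OPTIONS --safe #-}
module Submission where

-- Fix a basis X and write w for the maximizer on X, g = ∇u(w) and q = M/m ≥ 1.  Smoothness makes
-- g vanish on X, and bounds the gain of swapping x for y below by (g_y²/M - M w_x²)/2.  If no swap
-- has a bound above G, then X is a locally optimal basis for the weights M w_x² on X and
-- g_y²/M - 2G off X, so it is a globally optimal one; strong concavity turns the comparison with
-- a basis containing X* into f(X*) ≤ q s G + q² f(X).  Hence the gap f(X*)/q² - f(X) is at most 0
-- when the algorithm stops, and is multiplied by at most 1 - q/s in every other iteration.  It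
-- remains to bound (1 - a)^T by exp(-aT): exp(z + h) is within h² exp(b) of (1 + h) exp(z) when
-- |z|, |z + h| ≤ b, so walking from 0 to -aT in steps of length a/ν costs only O(1/ν).

open import Defs
open import Algebra.Bundles using (RawRing)
import Algebra.Properties.Ring as RingProperties
import Algebra.Properties.Semiring.Exp as Exp
import Algebra.Properties.Semiring.Mult as Mult
import Algebra.Properties.Semiring.Mult.TCOptimised as Mult′
import Algebra.Properties.Semiring.Sum as Sum
import Algebra.Solver.Ring as RingSolver
open import Algebra.Solver.Ring.AlmostCommutativeRing
  using (_-Raw-AlmostCommutative⟶_; fromCommutativeRing)
open import Data.Bool.Base using (if_then_else_; not)
open import Data.Empty using (⊥-elim)
open import Data.Fin.Base using (Fin; zero; suc)
import Data.Fin.Properties as Finₚ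
open import Data.Fin.Subset
  using (Subset; _∈_; _∉_; _⊆_; _⊂_; _∪_; _∩_; _─_; ⁅_⁆; ∣_∣; ⊥; inside; outside)
  renaming (_-_ to _∖_)
open import Data.Fin.Subset.Properties
open import Data.Integer.Base as ℤ using (ℤ; _⊖_) renaming (+_ to pos; -[1+_] to negsuc)
import Data.Integer.Properties as ℤₚ
open import Data.Maybe.Base using (Maybe; map)
open import Data.Nat.Base as ℕ using (ℕ; zero; suc; _!) renaming (_*_ to _*ℕ_; _≤_ to _≤ℕ_)
import Data.Nat.Properties as ℕₚ
open import Data.Product.Base using (∃; _×_; _,_; proj₁; proj₂)
open import Data.Sum.Base using (_⊎_; inj₁; inj₂)
open import Data.Vec.Base using ([]; _∷_; lookup; here; there; _[_]≔_)
import Data.Vec.Properties as Vecₚ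
open import Function.Base using (_∘_; const)
open import Relation.Binary.PropositionalEquality
  using (_≡_; _≢_; refl; sym; trans; cong; cong₂; subst; subst₂; module ≡-Reasoning)
open import Relation.Nullary using (¬_; yes; no; ¬?; _×-dec_; does)
open import Relation.Nullary.Decidable using (dec⇒maybe)
open import Relation.Unary using (Decidable)

-- The weights take the place of an exchange bijection between two bases: comparing total weights
-- only needs every single swap to be unprofitable. The shift by 2G arranges this and costs 2G for
-- each of the s elements of the competing basis, hence the term q s G. The factor q² has two
-- sources. Off X, strong concavity allows a competitor to earn g_y²/m in a coordinate, which is q
-- times the g_y²/M that smoothness guarantees; so all weights are scaled by q. On X, a dropped
-- coordinate costs the competitor only m w_x², while the scaled weight charges q M w_x². The excess
-- (qM - m)‖w‖² = (q² - 1) m‖w‖² has to be paid back, and strong concavity towards the origin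
-- together with u(0) ≥ 0 bounds it by 2(q² - 1) f(X). The two rules enter only through two
-- inequalities: the gain of the selected pair is at least half the bound of every admissible swap,
-- and at most the actual increase of f. One obstacle remains: q/s may exceed 1, and then 1 - q/s is
-- negative and useless for iteration. The contraction is therefore run with a ratio that is at
-- least max(1 - q/s, 0).

private
  variable
    n : ℕ

-- Ordered-field arithmetic, with a ring solver over integer coefficients

module OrderedFieldProperties (F : OrderedField) where
  open OrderedField F
  open RingProperties ring
    using (-‿distribˡ-*; -‿distribʳ-*; -‿involutive; -‿+-comm; -0#≈0#)
  open Mult′ semiring using (×-homo-+; ×1-homo-*; 1+×) renaming (_×_ to _×′_)

  private
    -- With the optimised multiple, `1 ×′ 1#` computes to `1#`, whereas `1 · 1#` is `1# + 0#`. This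
    -- makes `1-homo` hold by `refl` and lets the solver constant for one denote `1#` itself.
    ⟦_⟧ : ℤ → ℝ
    ⟦ pos k ⟧      = k ×′ 1#
    ⟦ (negsuc k) ⟧ = - (suc k ×′ 1#)

    ⟦-⟧ : ∀ i → ⟦ ℤ.- i ⟧ ≡ - ⟦ i ⟧
    ⟦-⟧ (pos zero)  = sym -0#≈0#
    ⟦-⟧ (pos (suc k)) = refl
    ⟦-⟧ (negsuc k)  = sym (-‿involutive _)

    x+y-[x+z] : ∀ x y z → (x + y) - (x + z) ≡ y - z
    x+y-[x+z] x y z = begin
      (x + y) - (x + z)      ≡⟨ cong ((x + y) +_) (sym (-‿+-comm x z)) ⟩
      (x + y) + (- x - z)    ≡⟨ cong (_+ (- x - z)) (+-comm x y) ⟩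
      (y + x) + (- x - z)    ≡⟨ +-assoc y x _ ⟩
      y + (x + (- x - z))    ≡⟨ cong (y +_) (sym (+-assoc x (- x) _)) ⟩
      y + ((x - x) - z)      ≡⟨ cong (λ t → y + (t - z)) (-‿inverseʳ x) ⟩
      y + (0# - z)           ≡⟨ cong (y +_) (+-identityˡ _) ⟩
      y - z                  ∎
      where open ≡-Reasoning

    ⟦⊖⟧ : ∀ i j → ⟦ i ⊖ j ⟧ ≡ i ×′ 1# - j ×′ 1#
    ⟦⊖⟧ i       zero    = sym (trans (cong (i ×′ 1# +_) -0#≈0#) (+-identityʳ _))
    ⟦⊖⟧ zero    (suc j) = sym (+-identityˡ _)
    ⟦⊖⟧ (suc i) (suc j) = begin
      ⟦ suc i ⊖ suc j ⟧                  ≡⟨ cong ⟦_⟧ (ℤₚ.[1+m]⊖[1+n]≡m⊖n i j) ⟩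
      ⟦ i ⊖ j ⟧                          ≡⟨ ⟦⊖⟧ i j ⟩
      i ×′ 1# - j ×′ 1#                  ≡⟨ sym (x+y-[x+z] 1# _ _) ⟩
      (1# + i ×′ 1#) - (1# + j ×′ 1#)    ≡⟨ sym (cong₂ _-_ (1+× i 1#) (1+× j 1#)) ⟩
      suc i ×′ 1# - suc j ×′ 1#          ∎
      where open ≡-Reasoning

    ⟦+⟧ : ∀ i j → ⟦ i ℤ.+ j ⟧ ≡ ⟦ i ⟧ + ⟦ j ⟧
    ⟦+⟧ (pos i)      (pos j)      = ×-homo-+ 1# i j
    ⟦+⟧ (pos i)      (negsuc j)   = ⟦⊖⟧ i (suc j)
    ⟦+⟧ (negsuc i)   (pos j)      = trans (⟦⊖⟧ j (suc i)) (+-comm _ _)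
    ⟦+⟧ (negsuc i)   (negsuc j)   = trans
      (cong -_ (trans (cong (λ k → suc k ×′ 1#) (sym (ℕₚ.+-suc i j))) (×-homo-+ 1# (suc i) (suc j))))
      (sym (-‿+-comm _ _))

    ⟦*⟧⁺ : ∀ i j → ⟦ pos i ℤ.* pos j ⟧ ≡ i ×′ 1# * j ×′ 1#
    ⟦*⟧⁺ i j = trans (cong ⟦_⟧ (sym (ℤₚ.pos-* i j))) (×1-homo-* i j)

    pos-⟦*⟧ : ∀ i j → ⟦ pos i ℤ.* j ⟧ ≡ ⟦ pos i ⟧ * ⟦ j ⟧
    pos-⟦*⟧ i (pos j) = ⟦*⟧⁺ i j
    pos-⟦*⟧ i (negsuc j) = begin
      ⟦ pos i ℤ.* (negsuc j) ⟧        ≡⟨ cong ⟦_⟧ (sym (ℤₚ.neg-distribʳ-* (pos i) (pos (suc j)))) ⟩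
      ⟦ ℤ.- (pos i ℤ.* pos (suc j)) ⟧   ≡⟨ ⟦-⟧ (pos i ℤ.* pos (suc j)) ⟩
      - ⟦ pos i ℤ.* pos (suc j) ⟧       ≡⟨ cong -_ (⟦*⟧⁺ i (suc j)) ⟩
      - (⟦ pos i ⟧ * ⟦ pos (suc j) ⟧)   ≡⟨ -‿distribʳ-* _ _ ⟩
      ⟦ pos i ⟧ * ⟦ (negsuc j) ⟧      ∎
      where open ≡-Reasoning
    ⟦*⟧ : ∀ i j → ⟦ i ℤ.* j ⟧ ≡ ⟦ i ⟧ * ⟦ j ⟧
    ⟦*⟧ (pos i) j = pos-⟦*⟧ i j
    ⟦*⟧ (negsuc i) j = begin
      ⟦ (negsuc i) ℤ.* j ⟧          ≡⟨ cong ⟦_⟧ (sym (ℤₚ.neg-distribˡ-* (pos (suc i)) j)) ⟩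
      ⟦ ℤ.- (pos (suc i) ℤ.* j) ⟧     ≡⟨ ⟦-⟧ (pos (suc i) ℤ.* j) ⟩
      - ⟦ pos (suc i) ℤ.* j ⟧         ≡⟨ cong -_ (pos-⟦*⟧ (suc i) j) ⟩
      - (⟦ pos (suc i) ⟧ * ⟦ j ⟧)     ≡⟨ -‿distribˡ-* _ _ ⟩
      ⟦ (negsuc i) ⟧ * ⟦ j ⟧        ∎
      where open ≡-Reasoning

    ℤ-rawRing : RawRing _ _
    ℤ-rawRing = record
      { _≈_ = _≡_ ; _+_ = ℤ._+_ ; _*_ = ℤ._*_ ; -_ = ℤ.-_ ; 0# = ℤ.0ℤ ; 1# = ℤ.1ℤ }

    ℤ⟶ℝ : ℤ-rawRing -Raw-AlmostCommutative⟶ fromCommutativeRing commutativeRing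
    ℤ⟶ℝ = record
      { ⟦_⟧ = ⟦_⟧ ; +-homo = ⟦+⟧ ; *-homo = ⟦*⟧ ; -‿homo = ⟦-⟧ ; 0-homo = refl ; 1-homo = refl }

    ℤ-coefficient≟ : ∀ i j → Maybe (⟦ i ⟧ ≡ ⟦ j ⟧)
    ℤ-coefficient≟ i j = map (cong ⟦_⟧) (dec⇒maybe (i ℤₚ.≟ j))

  open RingSolver ℤ-rawRing (fromCommutativeRing commutativeRing) ℤ⟶ℝ ℤ-coefficient≟ public
    using (solve; _:=_; _:+_; _:*_; _:-_; :-_; con; Polynomial)

  -- `:2` copies the unfolding of `2#` as `1# + (1# + 0#)`, so solved equations match goals
  -- containing `2#` without conversion.
  :0 :1 :2 : ∀ {k} → Polynomial k
  :0 = con (pos 0)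
  :1 = con (pos 1)
  :2 = :1 :+ (:1 :+ :0)

  ^2≡* : ∀ x → x ^ 2 ≡ x * x
  ^2≡* x = cong (x *_) (*-identityʳ x)

  <⇒≢0 : ∀ {x} → 0# < x → x ≢ 0#
  <⇒≢0 (_ , 0≢x) x≡0 = 0≢x (sym x≡0)

  +-mono-≤ : ∀ {a b c d} → a ≤ b → c ≤ d → a + c ≤ b + d
  +-mono-≤ {a} {b} {c} {d} p q =
    ≤-trans (+-monoˡ-≤ c p) (subst₂ _≤_ (+-comm c b) (+-comm d b) (+-monoˡ-≤ b q))

  +-nonNeg : ∀ {a b} → 0# ≤ a → 0# ≤ b → 0# ≤ a + b
  +-nonNeg {a} {b} p q = subst (_≤ a + b) (+-identityˡ 0#) (+-mono-≤ p q)

  ≤⇒0≤- : ∀ {x y} → x ≤ y → 0# ≤ y - x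
  ≤⇒0≤- {x} {y} p = subst (_≤ y - x) (-‿inverseʳ x) (+-monoˡ-≤ (- x) p)

  ≤-by : ∀ {x y z} → 0# ≤ z → z ≡ y - x → x ≤ y
  ≤-by {x} {y} 0≤z refl = subst₂ _≤_ (+-identityˡ x)
    (solve 2 (λ x y → (y :- x) :+ x := y) refl x y) (+-monoˡ-≤ x 0≤z)

  neg-nonNeg : ∀ {x} → x ≤ 0# → 0# ≤ - x
  neg-nonNeg {x} x≤0 = subst (0# ≤_) (+-identityˡ _) (≤⇒0≤- x≤0)

  0≤x*x : ∀ x → 0# ≤ x * x
  0≤x*x x with total 0# x
  ... | inj₁ 0≤x = *-nonNeg 0≤x 0≤x
  ... | inj₂ x≤0 = subst (0# ≤_) (solve 1 (λ x → :- x :* :- x := x :* x) refl x)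
                     (*-nonNeg (neg-nonNeg x≤0) (neg-nonNeg x≤0))

  0≤1 : 0# ≤ 1#
  0≤1 = subst (0# ≤_) (*-identityʳ 1#) (0≤x*x 1#)

  ≰⇒> : ∀ {x y} → ¬ (x ≤ y) → y < x
  ≰⇒> {x} {y} x≰y with total x y
  ... | inj₁ x≤y = ⊥-elim (x≰y x≤y)
  ... | inj₂ y≤x = y≤x , λ y≡x → x≰y (≤-reflexive (sym y≡x))

  <⇒≱ : ∀ {x y} → x < y → ¬ (y ≤ x)
  <⇒≱ (x≤y , x≢y) y≤x = x≢y (≤-antisym x≤y y≤x)

  <⇒0<- : ∀ {x y} → x < y → 0# < y - x
  <⇒0<- {x} {y} (x≤y , x≢y) = ≤⇒0≤- x≤y , λ 0≡y-x → x≢y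
    (trans (trans (sym (+-identityˡ x)) (cong (_+ x) 0≡y-x))
           (solve 2 (λ x y → (y :- x) :+ x := y) refl x y))

  <-≤-trans : ∀ {x y z} → x < y → y ≤ z → x < z
  <-≤-trans (x≤y , x≢y) y≤z =
    ≤-trans x≤y y≤z , λ { refl → x≢y (≤-antisym x≤y y≤z) }

  *-monoˡ-≤ : ∀ {x y} z → 0# ≤ z → x ≤ y → z * x ≤ z * y
  *-monoˡ-≤ {x} {y} z 0≤z x≤y = ≤-by (*-nonNeg 0≤z (≤⇒0≤- x≤y))
    (solve 3 (λ x y z → z :* (y :- x) := z :* y :- z :* x) refl x y z)

  *-mono-≤ : ∀ {a b c d} → 0# ≤ a → 0# ≤ c → a ≤ b → c ≤ d → a * c ≤ b * d
  *-mono-≤ {a} {b} {c} {d} 0≤a 0≤c a≤b c≤d =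
    ≤-trans (*-monoˡ-≤ a 0≤a c≤d)
      (subst₂ _≤_ (*-comm d a) (*-comm d b) (*-monoˡ-≤ d (≤-trans 0≤c c≤d) a≤b))

  ⁻¹-inverseˡ : ∀ {x} → x ≢ 0# → x ⁻¹ * x ≡ 1#
  ⁻¹-inverseˡ x≢0 = trans (*-comm _ _) (⁻¹-inverseʳ x≢0)

  *-cancelˡ-≡ : ∀ {x y z} → z ≢ 0# → z * x ≡ z * y → x ≡ y
  *-cancelˡ-≡ {x} {y} {z} z≢0 eq = trans (sym (lemma x)) (trans (cong (z ⁻¹ *_) eq) (lemma y))
    where
    lemma : ∀ a → z ⁻¹ * (z * a) ≡ a
    lemma a = trans (sym (*-assoc _ _ _))
      (trans (cong (_* a) (⁻¹-inverseˡ z≢0)) (*-identityˡ a))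

  *-cancelˡ-≤ : ∀ {x y z} → 0# < z → z * x ≤ z * y → x ≤ y
  *-cancelˡ-≤ {x} {y} {z} 0<z zx≤zy with x ≤? y
  ... | yes x≤y = x≤y
  ... | no x≰y with ≰⇒> x≰y
  ...   | y≤x , y≢x = ⊥-elim (y≢x (*-cancelˡ-≡ (<⇒≢0 0<z)
                        (≤-antisym (*-monoˡ-≤ z (proj₁ 0<z) y≤x) zx≤zy)))

  *-pos : ∀ {x y} → 0# < x → 0# < y → 0# < x * y
  *-pos {x} {y} 0<x 0<y = *-nonNeg (proj₁ 0<x) (proj₁ 0<y) , λ 0≡xy →
    proj₂ 0<y (*-cancelˡ-≡ (<⇒≢0 0<x) (trans (zeroʳ x) 0≡xy))

  0<1 : 0# < 1#
  0<1 = 0≤1 , 0≢1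

  ⁻¹-pos : ∀ {x} → 0# < x → 0# < x ⁻¹
  ⁻¹-pos {x} 0<x =
      *-cancelˡ-≤ 0<x (subst₂ _≤_ (sym (zeroʳ x)) (sym (⁻¹-inverseʳ (<⇒≢0 0<x))) 0≤1)
    , λ 0≡x⁻¹ → 0≢1 (trans (trans (sym (zeroʳ x)) (cong (x *_) 0≡x⁻¹)) (⁻¹-inverseʳ (<⇒≢0 0<x)))

  /-pos : ∀ {x y} → 0# < x → 0# < y → 0# < x / y
  /-pos 0<x 0<y = *-pos 0<x (⁻¹-pos 0<y)

  *-/-cancel : ∀ x {y} → y ≢ 0# → y * (x / y) ≡ x
  *-/-cancel x {y} y≢0 = trans (*-comm y (x / y)) (trans (*-assoc x (y ⁻¹) y)
    (trans (cong (x *_) (⁻¹-inverseˡ y≢0)) (*-identityʳ x)))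

  ^-nonNeg : ∀ {x} k → 0# ≤ x → 0# ≤ x ^ k
  ^-nonNeg zero    0≤x = 0≤1
  ^-nonNeg (suc k) 0≤x = *-nonNeg 0≤x (^-nonNeg k 0≤x)

  ^-monoˡ-≤ : ∀ {x y} k → 0# ≤ x → x ≤ y → x ^ k ≤ y ^ k
  ^-monoˡ-≤ zero    0≤x x≤y = ≤-refl
  ^-monoˡ-≤ (suc k) 0≤x x≤y = *-mono-≤ 0≤x (^-nonNeg k 0≤x) x≤y (^-monoˡ-≤ k 0≤x x≤y)

  fromℕ-nonNeg : ∀ k → 0# ≤ fromℕ k
  fromℕ-nonNeg zero    = ≤-refl
  fromℕ-nonNeg (suc k) = +-nonNeg 0≤1 (fromℕ-nonNeg k)

  1≤fromℕ-suc : ∀ k → 1# ≤ fromℕ (suc k)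
  1≤fromℕ-suc k = subst (_≤ fromℕ (suc k)) (+-identityʳ 1#) (+-mono-≤ ≤-refl (fromℕ-nonNeg k))

  0<fromℕ-suc : ∀ k → 0# < fromℕ (suc k)
  0<fromℕ-suc k = <-≤-trans 0<1 (1≤fromℕ-suc k)

  fromℕ-pos : ∀ {k} → 1 ℕ.≤ k → 0# < fromℕ k
  fromℕ-pos (ℕ.s≤s {n = k} _) = 0<fromℕ-suc k

  fromℕ-mono-≤ : ∀ {i j} → i ℕ.≤ j → fromℕ i ≤ fromℕ j
  fromℕ-mono-≤ {j = j} ℕ.z≤n = fromℕ-nonNeg j
  fromℕ-mono-≤ (ℕ.s≤s i≤j)   = +-mono-≤ ≤-refl (fromℕ-mono-≤ i≤j)

  fromℕ-* : ∀ i j → fromℕ (i ℕ.* j) ≡ fromℕ i * fromℕ j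
  fromℕ-* = Mult.×1-homo-* semiring

  -- The discarded term is k h². The inequality serves to replace one factor 1 - a by ν finer
  -- factors 1 - a/ν.
  bernoulli : ∀ {h} k → 0# ≤ h → h ≤ 1# → 1# - fromℕ k * h ≤ (1# - h) ^ k
  bernoulli {h} zero    0≤h h≤1 = ≤-reflexive (solve 1 (λ h → :1 :- :0 :* h := :1) refl h)
  bernoulli {h} (suc k) 0≤h h≤1 = ≤-trans
    (≤-by (*-nonNeg (fromℕ-nonNeg k) (0≤x*x h))
      (solve 2 (λ k h → k :* (h :* h)
                  := (:1 :- h) :* (:1 :- k :* h) :- (:1 :- (:1 :+ k) :* h)) refl (fromℕ k) h))
    (*-monoˡ-≤ (1# - h) (≤⇒0≤- h≤1) (bernoulli k 0≤h h≤1))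

  -- This is how inequalities pass to the limit: values of `exp` are known up to ε, and c collects
  -- the coefficients of the errors. If x > y, the choice ε = (x - y)/(1 + c) turns the assumption
  -- into ε ≤ 0.
  ≤-by-slack : ∀ {x y c} → 0# ≤ c → (∀ ε → 0# < ε → x ≤ y + ε * c) → x ≤ y
  ≤-by-slack {x} {y} {c} 0≤c x≤y+ε with x ≤? y
  ... | yes x≤y = x≤y
  ... | no x≰y = ⊥-elim (<⇒≱ 0<ε ε≤0)
    where
    0<1+c = <-≤-trans 0<1 (subst (_≤ 1# + c) (+-identityʳ 1#) (+-mono-≤ ≤-refl 0≤c))
    ε = (x - y) / (1# + c)
    0<ε = /-pos (<⇒0<- (≰⇒> x≰y)) 0<1+c
    ε≤0 : ε ≤ 0#
    ε≤0 = ≤-by (≤⇒0≤- (x≤y+ε ε 0<ε)) (begin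
      (y + ε * c) - x                   ≡⟨ solve 4 (λ x y c e → (y :+ e :* c) :- x
                                             := ((:1 :+ c) :* e :- (x :- y)) :- e) refl x y c ε ⟩
      ((1# + c) * ε - (x - y)) - ε      ≡⟨ cong (λ d → (d - (x - y)) - ε) (*-/-cancel (x - y) (<⇒≢0 0<1+c)) ⟩
      ((x - y) - (x - y)) - ε           ≡⟨ cong (_- ε) (-‿inverseʳ (x - y)) ⟩
      0# - ε                            ∎)
      where open ≡-Reasoning

  infix 4 ∣_∣≤_
  -- The two-sided form is used in place of `abs`, whose value depends on a case split on the sign.
  ∣_∣≤_ : ℝ → ℝ → Set
  ∣ a ∣≤ b = - b ≤ a × a ≤ b

  ∣∣≤⇒0≤+ : ∀ {a b} → ∣ a ∣≤ b → 0# ≤ b + a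
  ∣∣≤⇒0≤+ {a} {b} (p , _) = subst (0# ≤_) (solve 2 (λ a b → a :- :- b := b :+ a) refl a b) (≤⇒0≤- p)

  ∣∣≤⇒0≤- : ∀ {a b} → ∣ a ∣≤ b → 0# ≤ b - a
  ∣∣≤⇒0≤- (_ , q) = ≤⇒0≤- q

  0≤±⇒∣∣≤ : ∀ {a b} → 0# ≤ b + a → 0# ≤ b - a → ∣ a ∣≤ b
  0≤±⇒∣∣≤ {a} {b} p q =
    ≤-by p (solve 2 (λ a b → b :+ a := a :- :- b) refl a b) , ≤-by q refl

  ∣∣≤-bound-nonNeg : ∀ {a b} → ∣ a ∣≤ b → 0# ≤ b
  ∣∣≤-bound-nonNeg {a} {b} h with total 0# a
  ... | inj₁ 0≤a = ≤-trans 0≤a (proj₂ h)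
  ... | inj₂ a≤0 = ≤-trans (∣∣≤⇒0≤+ h) (subst (b + a ≤_) (+-identityʳ b) (+-mono-≤ ≤-refl a≤0))

  ∣+∣≤ : ∀ {a b c d} → ∣ a ∣≤ b → ∣ c ∣≤ d → ∣ a + c ∣≤ b + d
  ∣+∣≤ {b = b} {d = d} (p , q) (p′ , q′) =
    subst (_≤ _) (-‿+-comm b d) (+-mono-≤ p p′) , +-mono-≤ q q′

  ∣∣≤-trans : ∀ {a b c} → ∣ a ∣≤ b → b ≤ c → ∣ a ∣≤ c
  ∣∣≤-trans {a} {b} {c} (p , q) b≤c =
      ≤-trans (≤-by (≤⇒0≤- b≤c) (solve 2 (λ b c → c :- b := :- b :- :- c) refl b c)) p
    , ≤-trans q b≤c

  half-nonNeg : ∀ {z} → 0# ≤ z + z → 0# ≤ z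
  half-nonNeg {z} h with total 0# z
  ... | inj₁ 0≤z = 0≤z
  ... | inj₂ z≤0 = ≤-trans h (subst (z + z ≤_) (+-identityʳ z) (+-mono-≤ ≤-refl z≤0))

  -- Twice bd + ac is (b + a)(d + c) + (b - a)(d - c), and twice bd - ac is (b + a)(d - c) + (b -
  -- a)(d + c). All factors are nonnegative, so no signs need to be distinguished.
  ∣*∣≤ : ∀ {a b c d} → ∣ a ∣≤ b → ∣ c ∣≤ d → ∣ a * c ∣≤ b * d
  ∣*∣≤ {a} {b} {c} {d} h k = 0≤±⇒∣∣≤
    (half-nonNeg (subst (0# ≤_)
      (solve 4 (λ a b c d → (b :+ a) :* (d :+ c) :+ (b :- a) :* (d :- c)
                 := (b :* d :+ a :* c) :+ (b :* d :+ a :* c)) refl a b c d)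
      (+-nonNeg (*-nonNeg (∣∣≤⇒0≤+ h) (∣∣≤⇒0≤+ k)) (*-nonNeg (∣∣≤⇒0≤- h) (∣∣≤⇒0≤- k)))))
    (half-nonNeg (subst (0# ≤_)
      (solve 4 (λ a b c d → (b :+ a) :* (d :- c) :+ (b :- a) :* (d :+ c)
                 := (b :* d :- a :* c) :+ (b :* d :- a :* c)) refl a b c d)
      (+-nonNeg (*-nonNeg (∣∣≤⇒0≤+ h) (∣∣≤⇒0≤- k)) (*-nonNeg (∣∣≤⇒0≤- h) (∣∣≤⇒0≤+ k)))))

  ∣∣≤-cancelˡ : ∀ {a b z} → 0# < z → ∣ z * a ∣≤ z * b → ∣ a ∣≤ b
  ∣∣≤-cancelˡ {a} {b} {z} 0<z (p , q) =
    *-cancelˡ-≤ 0<z (subst (_≤ z * a) (-‿distribʳ-* z b) p) , *-cancelˡ-≤ 0<z q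

  ∣∣≤-self : ∀ {a} → 0# ≤ a → ∣ a ∣≤ a
  ∣∣≤-self {a} 0≤a = 0≤±⇒∣∣≤ (+-nonNeg 0≤a 0≤a) (≤-reflexive (sym (-‿inverseʳ a)))

  abs<⇒∣∣≤ : ∀ {a ε} → abs a < ε → ∣ a ∣≤ ε
  abs<⇒∣∣≤ {a} {ε} (h , _) with total 0# a
  ... | inj₁ 0≤a = ∣∣≤-trans (∣∣≤-self 0≤a) h
  ... | inj₂ a≤0 = ∣∣≤-trans (≤-reflexive (-‿involutive a) , ≤-trans a≤0 (neg-nonNeg a≤0)) h

-- Bounding powers of 1 - a by the exponential

module ExponentialProperties (R : Reals) where
  open Reals R
  open Exponential R
  open OrderedFieldProperties orderedField

  fromℕ-!-pos : ∀ k → 0# < fromℕ (k !)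
  fromℕ-!-pos k = fromℕ-pos (ℕ.>-nonZero⁻¹ (k !) {{k ℕₚ.!≢0}})

  -- Together with `expTerm-0`, this recurrence replaces powers and factorials in all later
  -- estimates.
  expTerm-suc : ∀ x k → fromℕ (suc k) * expTerm x (suc k) ≡ x * expTerm x k
  expTerm-suc x k = *-cancelˡ-≡ b≢0 (begin
    b * (a * (x * p * c ⁻¹))   ≡⟨ solve 5 (λ a b x p i → b :* (a :* (x :* p :* i)) := x :* p :* (a :* b :* i))
        refl a b x p (c ⁻¹) ⟩
    x * p * (a * b * c ⁻¹)     ≡⟨ cong (λ z → x * p * (z * c ⁻¹)) (sym (fromℕ-* (suc k) (k !))) ⟩
    x * p * (c * c ⁻¹)         ≡⟨ cong (x * p *_) (⁻¹-inverseʳ (<⇒≢0 (fromℕ-!-pos (suc k)))) ⟩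
    x * p * 1#                 ≡⟨ cong (x * p *_) (sym (⁻¹-inverseʳ b≢0)) ⟩
    x * p * (b * b ⁻¹)         ≡⟨ solve 4 (λ x p b i → x :* p :* (b :* i) := b :* (x :* (p :* i)))
        refl x p b (b ⁻¹) ⟩
    b * (x * (p * b ⁻¹))       ∎)
    where
    open ≡-Reasoning
    a = fromℕ (suc k)
    b = fromℕ (k !)
    c = fromℕ (suc k !)
    p = x ^ k
    b≢0 = <⇒≢0 (fromℕ-!-pos k)

  expTerm-0 : ∀ x → expTerm x 0 ≡ 1#
  expTerm-0 x = *-cancelˡ-≡ (<⇒≢0 (0<fromℕ-suc 0)) (trans (*-/-cancel 1# (<⇒≢0 (0<fromℕ-suc 0)))
    (solve 0 (:1 := (:1 :+ :0) :* :1) refl))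

  ∣expTerm∣≤ : ∀ {x b} → ∣ x ∣≤ b → ∀ k → ∣ expTerm x k ∣≤ expTerm b k
  ∣expTerm∣≤ {x} {b} h zero = subst₂ ∣_∣≤_ (sym (expTerm-0 x)) (sym (expTerm-0 b)) (∣∣≤-self 0≤1)
  ∣expTerm∣≤ {x} {b} h (suc k) = ∣∣≤-cancelˡ (0<fromℕ-suc k)
    (subst₂ ∣_∣≤_ (sym (expTerm-suc x k)) (sym (expTerm-suc b k)) (∣*∣≤ h (∣expTerm∣≤ h k)))

  expTerm-nonNeg : ∀ {x} → 0# ≤ x → ∀ k → 0# ≤ expTerm x k
  expTerm-nonNeg 0≤x k = ∣∣≤-bound-nonNeg (∣expTerm∣≤ (∣∣≤-self 0≤x) k)

  1≤expSum : ∀ {x} → 0# ≤ x → ∀ k → 1# ≤ expSum x (suc k)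
  1≤expSum {x} 0≤x zero    = ≤-reflexive (sym (trans (+-identityˡ _) (expTerm-0 x)))
  1≤expSum {x} 0≤x (suc k) = subst (_≤ expSum x (suc (suc k))) (+-identityʳ 1#)
    (+-mono-≤ (1≤expSum 0≤x k) (expTerm-nonNeg 0≤x (suc k)))

  expSum-near : ∀ x {ε} → 0# < ε → ∃ λ N → ∀ i → N ℕ.≤ i → ∣ expSum x i - exp x ∣≤ ε
  expSum-near x {ε} 0<ε with expSum-converges x ε 0<ε
  ... | N , near = N , λ i N≤i → abs<⇒∣∣≤ (near i N≤i)

  1≤exp : ∀ {x} → 0# ≤ x → 1# ≤ exp x
  1≤exp {x} 0≤x = ≤-by-slack 0≤1 λ ε 0<ε →
    let N , near = expSum-near x 0<ε
        (l , u) = near (suc N) (ℕₚ.n≤1+n N)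
    in ≤-trans (1≤expSum 0≤x N)
         (≤-by (≤⇒0≤- u) (solve 3 (λ s e ε → ε :- (s :- e) := (e :+ ε :* :1) :- s) refl
           (expSum x (suc N)) (exp x) ε))

  module _ {x y b} (∣x∣≤b : ∣ x ∣≤ b) (∣y∣≤b : ∣ y ∣≤ b) where

    private
      h = y - x

    -- The degree k + 1 part of  exp y - exp x - (y - x) exp x.
    remainder : ℕ → ℝ
    remainder k = expTerm y (suc k) - expTerm x (suc k) - h * expTerm x k

    remainder-0 : remainder 0 ≡ 0#
    remainder-0 = *-cancelˡ-≡ (<⇒≢0 (0<fromℕ-suc 0)) (begin
      c * (y₁ - x₁ - h * x₀)
        ≡⟨ solve 5 (λ c y₁ x₁ h x₀ → c :* (y₁ :- x₁ :- h :* x₀) := c :* y₁ :- c :* x₁ :- c :* (h :* x₀))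
            refl c y₁ x₁ h x₀ ⟩
      c * y₁ - c * x₁ - c * (h * x₀)
        ≡⟨ cong₂ (λ p q → p - q - c * (h * x₀)) (trans (expTerm-suc y 0) (cong (y *_) (expTerm-0 y)))
             (trans (expTerm-suc x 0) (cong (x *_) (expTerm-0 x))) ⟩
      y * 1# - x * 1# - c * (h * x₀)
        ≡⟨ cong (λ p → y * 1# - x * 1# - c * (h * p)) (expTerm-0 x) ⟩
      y * 1# - x * 1# - c * (h * 1#)
        ≡⟨ solve 2 (λ x y → y :* :1 :- x :* :1 :- (:1 :+ :0) :* ((y :- x) :* :1) := (:1 :+ :0) :* :0) refl x y ⟩
      c * 0# ∎)
      where
      open ≡-Reasoning
      c = fromℕ 1
      y₁ = expTerm y 1
      x₁ = expTerm x 1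
      x₀ = expTerm x 0

    -- The recurrence of the terms carries over to the remainders. Its inhomogeneous part has the
    -- factor h², which is where the quadratic error comes from.
    remainder-suc : ∀ k → fromℕ (suc (suc k)) * remainder (suc k) ≡ y * remainder k + h * h * expTerm x k
    remainder-suc k = begin
      c₂ * (y₂ - x₂ - h * x₁)
        ≡⟨ solve 5 (λ c y₂ x₂ h x₁ → (:1 :+ c) :* (y₂ :- x₂ :- h :* x₁)
             := (:1 :+ c) :* y₂ :- (:1 :+ c) :* x₂ :- h :* x₁ :- h :* (c :* x₁)) refl c₁ y₂ x₂ h x₁ ⟩
      c₂ * y₂ - c₂ * x₂ - h * x₁ - h * (c₁ * x₁)
        ≡⟨ cong₂ (λ p q → p - q - h * x₁ - h * (c₁ * x₁)) (expTerm-suc y (suc k)) (expTerm-suc x (suc k)) ⟩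
      y * y₁ - x * x₁ - h * x₁ - h * (c₁ * x₁)
        ≡⟨ cong (λ p → y * y₁ - x * x₁ - h * x₁ - h * p) (expTerm-suc x k) ⟩
      y * y₁ - x * x₁ - h * x₁ - h * (x * x₀)
        ≡⟨ solve 5 (λ x y y₁ x₁ x₀ → y :* y₁ :- x :* x₁ :- (y :- x) :* x₁ :- (y :- x) :* (x :* x₀)
             := y :* (y₁ :- x₁ :- (y :- x) :* x₀) :+ (y :- x) :* (y :- x) :* x₀) refl x y y₁ x₁ x₀ ⟩
      y * (y₁ - x₁ - h * x₀) + h * h * x₀ ∎
      where
      open ≡-Reasoning
      c₂ = fromℕ (suc (suc k))
      c₁ = fromℕ (suc k)
      y₂ = expTerm y (suc (suc k))
      x₂ = expTerm x (suc (suc k))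
      y₁ = expTerm y (suc k)
      x₁ = expTerm x (suc k)
      x₀ = expTerm x k

    private
      t : ℕ → ℝ
      t = expTerm b

      0≤t : ∀ k → 0# ≤ t k
      0≤t = expTerm-nonNeg (∣∣≤-bound-nonNeg ∣x∣≤b)

    -- The two bounds feed each other. Since b t_{k-1} = k t_k for the terms t of `exp b`, the first
    -- has a form that also covers k = 0, where the remainder vanishes. By `remainder-suc` it bounds
    -- (k + 2) times the next remainder by (k + 1) h² t_k, which leaves room to cancel k + 2.
    ∣y*remainder∣≤ : ∀ k → ∣ y * remainder k ∣≤ h * h * (fromℕ k * t k)
    ∣remainder∣≤   : ∀ k → ∣ remainder (suc k) ∣≤ h * h * t k

    ∣y*remainder∣≤ zero = subst₂ ∣_∣≤_
      (sym (trans (cong (y *_) remainder-0) (zeroʳ y)))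
      (solve 2 (λ h t → :0 := h :* h :* (:0 :* t)) refl h (t 0)) (∣∣≤-self ≤-refl)
    ∣y*remainder∣≤ (suc k) = ∣∣≤-trans (∣*∣≤ ∣y∣≤b (∣remainder∣≤ k)) (≤-reflexive (begin
      b * (h * h * t k)               ≡⟨ solve 3 (λ b h t → b :* (h :* h :* t) := h :* h :* (b :* t))
          refl b h (t k) ⟩
      h * h * (b * t k)               ≡⟨ cong (h * h *_) (sym (expTerm-suc b k)) ⟩
      h * h * (fromℕ (suc k) * t (suc k)) ∎))
      where open ≡-Reasoning
    ∣remainder∣≤ k = ∣∣≤-cancelˡ (0<fromℕ-suc (suc k)) (subst (∣_∣≤ fromℕ (suc (suc k)) * (h * h * t k)) (sym (remainder-suc k))
      (∣∣≤-trans (∣+∣≤ (∣y*remainder∣≤ k) (∣*∣≤ (∣∣≤-self (0≤x*x h)) (∣expTerm∣≤ ∣x∣≤b k)))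
        (≤-by (*-nonNeg (0≤x*x h) (0≤t k))
          (solve 3 (λ h c t → h :* h :* t
             := (:1 :+ (:1 :+ c)) :* (h :* h :* t) :- (h :* h :* (c :* t) :+ h :* h :* t))
             refl h (fromℕ k) (t k)))))

    -- Remainders 0 to k are added up. The sums have different lengths because degree j + 1 of
    -- `exp y` and `exp x` is paired with degree j of h exp x and degree j - 1 of h² exp b.
    expSum-linearization : ∀ k →
      expSum x (suc (suc k)) + h * expSum x (suc k) ≤ expSum y (suc (suc k)) + h * h * expSum b k
    expSum-linearization zero = ≤-reflexive (begin
      0# + x₀ + x₁ + h * (0# + x₀)
        ≡⟨ solve 4 (λ x₀ x₁ y₁ h → :0 :+ x₀ :+ x₁ :+ h :* (:0 :+ x₀)
             := :0 :+ x₀ :+ y₁ :+ h :* h :* :0 :- (y₁ :- x₁ :- h :* x₀)) refl x₀ x₁ y₁ h ⟩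
      0# + x₀ + y₁ + h * h * 0# - remainder 0
        ≡⟨ cong₂ (λ p q → 0# + p + y₁ + h * h * 0# - q) (trans (expTerm-0 x) (sym (expTerm-0 y))) remainder-0 ⟩
      0# + y₀ + y₁ + h * h * 0# - 0#
        ≡⟨ solve 3 (λ y₀ y₁ h → :0 :+ y₀ :+ y₁ :+ h :* h :* :0 :- :0 := :0 :+ y₀ :+ y₁ :+ h :* h :* :0)
            refl y₀ y₁ h ⟩
      0# + y₀ + y₁ + h * h * 0# ∎)
      where
      open ≡-Reasoning
      y₀ = expTerm y 0
      x₀ = expTerm x 0
      y₁ = expTerm y 1
      x₁ = expTerm x 1
    expSum-linearization (suc k) =
      ≤-by (+-nonNeg (≤⇒0≤- (expSum-linearization k)) (∣∣≤⇒0≤+ (∣remainder∣≤ k)))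
        (solve 9 (λ X₂ X₁ Y₂ S h x₂ x₁ y₂ t →
            ((Y₂ :+ h :* h :* S) :- (X₂ :+ h :* X₁)) :+ (h :* h :* t :+ (y₂ :- x₂ :- h :* x₁))
          := (Y₂ :+ y₂ :+ h :* h :* (S :+ t)) :- (X₂ :+ x₂ :+ h :* (X₁ :+ x₁))) refl
          (expSum x (suc (suc k))) (expSum x (suc k)) (expSum y (suc (suc k))) (expSum b k) h
          (expTerm x (suc (suc k))) (expTerm x (suc k)) (expTerm y (suc (suc k))) (t k))

  exp-backward-step : ∀ {b} h z → 0# ≤ h → 0# ≤ z → z + h ≤ b →
    (1# - h) * exp (- z) ≤ exp (- (z + h)) + h * h * exp b
  exp-backward-step {b} h z 0≤h 0≤z z+h≤b =
    -- The coefficients 1, h, 1 and h² belong to the errors of the two partial sums at `- z`, of the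
    -- one at `- (z + h)`, and of the one at `b`.
    ≤-by-slack (+-nonNeg (+-nonNeg (+-nonNeg 0≤1 0≤h) 0≤1) (0≤x*x h)) λ ε 0<ε →
    let x = - z
        y = - (z + h)
        N₁ , near₁ = expSum-near x 0<ε
        N₂ , near₂ = expSum-near y 0<ε
        N₃ , near₃ = expSum-near b 0<ε
        k = N₁ ℕ.+ N₂ ℕ.+ N₃
        N₁≤k : N₁ ℕ.≤ k
        N₁≤k = ℕₚ.≤-trans (ℕₚ.m≤m+n N₁ N₂) (ℕₚ.m≤m+n (N₁ ℕ.+ N₂) N₃)
        N₂≤k : N₂ ℕ.≤ k
        N₂≤k = ℕₚ.≤-trans (ℕₚ.m≤n+m N₂ N₁) (ℕₚ.m≤m+n (N₁ ℕ.+ N₂) N₃)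
        N₃≤k : N₃ ℕ.≤ k
        N₃≤k = ℕₚ.m≤n+m N₃ (N₁ ℕ.+ N₂)
        e₁ = near₁ (suc (suc k)) (ℕₚ.m≤n⇒m≤1+n (ℕₚ.m≤n⇒m≤1+n N₁≤k))
        e₁′ = near₁ (suc k) (ℕₚ.m≤n⇒m≤1+n N₁≤k)
        e₂ = near₂ (suc (suc k)) (ℕₚ.m≤n⇒m≤1+n (ℕₚ.m≤n⇒m≤1+n N₂≤k))
        e₃ = near₃ k N₃≤k
    in ≤-by
      (+-nonNeg (+-nonNeg (+-nonNeg (+-nonNeg (≤⇒0≤- (expSum-linearization ∣x∣≤b ∣y∣≤b k))
        (∣∣≤⇒0≤+ e₁)) (*-nonNeg 0≤h (∣∣≤⇒0≤- e₁′))) (∣∣≤⇒0≤- e₂)) (*-nonNeg (0≤x*x h) (∣∣≤⇒0≤- e₃)))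
      (solve 10 (λ z h X₂ X₁ Y₂ S ex ey eb ε →
          let d = :- (z :+ h) :- :- z in
          ((Y₂ :+ d :* d :* S) :- (X₂ :+ d :* X₁)) :+ (ε :+ (X₂ :- ex)) :+ h :* (ε :- (X₁ :- ex))
            :+ (ε :- (Y₂ :- ey)) :+ h :* h :* (ε :- (S :- eb))
          := ((ey :+ h :* h :* eb) :+ ε :* (:1 :+ h :+ :1 :+ h :* h)) :- (:1 :- h) :* ex) refl
        z h (expSum x (suc (suc k))) (expSum x (suc k)) (expSum y (suc (suc k))) (expSum b k)
        (exp x) (exp y) (exp b) ε)
    where
    0≤z+h = +-nonNeg 0≤z 0≤h
    ∣-∣≤ : ∀ {c d} → 0# ≤ c → c ≤ d → ∣ - c ∣≤ d
    ∣-∣≤ {c} {d} 0≤c c≤d = 0≤±⇒∣∣≤ (≤⇒0≤- c≤d)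
      (subst (0# ≤_) (solve 2 (λ c d → d :+ c := d :- :- c) refl c d) (+-nonNeg (≤-trans 0≤c c≤d) 0≤c))
    ∣y∣≤b : ∣ - (z + h) ∣≤ b
    ∣y∣≤b = ∣-∣≤ 0≤z+h z+h≤b
    ∣x∣≤b : ∣ - z ∣≤ b
    ∣x∣≤b = ∣-∣≤ 0≤z (≤-trans (≤-by 0≤h (solve 2 (λ z h → h := (z :+ h) :- z) refl z h)) z+h≤b)

  -- Multiplication by 1 - h, a number in [0, 1], does not enlarge the error accumulated so far, so
  -- the j errors merely add up.
  exp-backward-steps : ∀ {b} h j → 0# ≤ h → h ≤ 1# → fromℕ j * h ≤ b →
    (1# - h) ^ j ≤ exp (- (fromℕ j * h)) + fromℕ j * (h * h * exp b)
  exp-backward-steps {b} h zero 0≤h h≤1 _ = ≤-trans (1≤exp (≤-reflexive 0≡-[0*h]))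
    (≤-reflexive (solve 2 (λ e c → e := e :+ :0 :* c) refl (exp (- (0# * h))) (h * h * exp b)))
    where
    0≡-[0*h] : 0# ≡ - (0# * h)
    0≡-[0*h] = solve 1 (λ h → :0 := :- (:0 :* h)) refl h
  exp-backward-steps {b} h (suc j) 0≤h h≤1 jh+h≤b =
    ≤-by (+-nonNeg (+-nonNeg (*-nonNeg (≤⇒0≤- h≤1) (≤⇒0≤- ih)) (≤⇒0≤- step))
           (*-nonNeg 0≤h (*-nonNeg 0≤j 0≤c)))
      (trans (solve 6 (λ h e e′ j c p →
          (:1 :- h) :* ((e :+ j :* c) :- p) :+ ((e′ :+ c) :- (:1 :- h) :* e) :+ h :* (j :* c)
          := (e′ :+ (:1 :+ j) :* c) :- (:1 :- h) :* p) refl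
          h (exp (- z)) (exp (- (z + h))) (fromℕ j) c ((1# - h) ^ j))
        (cong (λ a → exp (- a) + (1# + fromℕ j) * c - (1# - h) * (1# - h) ^ j) z+h≡))
    where
    z = fromℕ j * h
    c = h * h * exp b
    z+h≡ : z + h ≡ fromℕ (suc j) * h
    z+h≡ = solve 2 (λ j h → j :* h :+ h := (:1 :+ j) :* h) refl (fromℕ j) h
    z+h≤b = subst (_≤ b) (sym z+h≡) jh+h≤b
    0≤j = fromℕ-nonNeg j
    0≤z = *-nonNeg 0≤j 0≤h
    z≤b = ≤-trans (≤-by 0≤h (solve 2 (λ z h → h := (z :+ h) :- z) refl z h)) z+h≤b
    ih = exp-backward-steps h j 0≤h h≤1 z≤b
    step = exp-backward-step h z 0≤h 0≤z z+h≤b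
    0≤c : 0# ≤ c
    0≤c = *-nonNeg (0≤x*x h) (≤-trans 0≤1 (1≤exp (≤-trans 0≤z z≤b)))

  -- By the Archimedean property a positive x - y would have unbounded multiples. An error of order
  -- 1/ν is thereby removed without taking a limit in ν.
  ≤-by-multiples : ∀ {x y c} → (∀ k → fromℕ (suc k) * (x - y) ≤ c) → x ≤ y
  ≤-by-multiples {x} {y} {c} h with x ≤? y
  ... | yes x≤y = x≤y
  ... | no x≰y = ⊥-elim (<⇒≱ 0<d (≤-by (≤⇒0≤- [1+k]d≤kd)
        (solve 2 (λ k d → k :* d :- (:1 :+ k) :* d := :0 :- d) refl (fromℕ k) d)))
    where
    d = x - y
    0<d = <⇒0<- (≰⇒> x≰y)
    k = proj₁ (archimedean (c / d))
    [1+k]d≤kd : fromℕ (suc k) * d ≤ fromℕ k * d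
    [1+k]d≤kd = ≤-trans (h k) (subst₂ _≤_ (*-/-cancel c (<⇒≢0 0<d)) (*-comm d (fromℕ k))
      (*-monoˡ-≤ d (proj₁ 0<d) (proj₂ (archimedean (c / d)))))

  -- With h = a/ν, Bernoulli gives 1 - a ≤ (1 - h)^ν, so νk fine steps dominate k coarse ones. Their
  -- total error νk h² exp b, multiplied by ν, is k a² exp b, which no longer depends on ν.
  [1-a]^k≤exp[-ak] : ∀ {a} k → 0# ≤ a → a ≤ 1# → (1# - a) ^ k ≤ exp (- (a * fromℕ k))
  [1-a]^k≤exp[-ak] {a} k 0≤a a≤1 = ≤-by-multiples {c = fromℕ k * (a * a * exp b)} bound
    where
    b = a * fromℕ k
    bound : ∀ i → fromℕ (suc i) * ((1# - a) ^ k - exp (- b)) ≤ fromℕ k * (a * a * exp b)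
    bound i = ≤-trans (*-monoˡ-≤ ν (proj₁ 0<ν) (≤-by (≤⇒0≤- coarse)
        (solve 3 (λ p e r → (e :+ r) :- p := r :- (p :- e)) refl
          ((1# - a) ^ k) (exp (- b)) (ν * fromℕ k * (h * h * exp b)))))
      (≤-reflexive (begin
        ν * (ν * fromℕ k * (h * h * exp b))  ≡⟨ solve 4 (λ ν k h e → ν :* (ν :* k :* (h :* h :* e))
                                                 := k :* (ν :* h :* (ν :* h) :* e)) refl ν (fromℕ k) h (exp b) ⟩
        fromℕ k * (ν * h * (ν * h) * exp b)  ≡⟨ cong (λ z → fromℕ k * (z * z * exp b)) νh≡a ⟩
        fromℕ k * (a * a * exp b)            ∎))
      where
      open ≡-Reasoning
      ν = fromℕ (suc i)
      0<ν = 0<fromℕ-suc i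
      h = a / ν
      νh≡a = *-/-cancel a (<⇒≢0 0<ν)
      0≤h : 0# ≤ h
      0≤h = *-nonNeg 0≤a (proj₁ (⁻¹-pos 0<ν))
      h≤a : h ≤ a
      h≤a = subst₂ _≤_ (*-identityˡ h) νh≡a (*-mono-≤ 0≤1 0≤h (1≤fromℕ-suc i) ≤-refl)
      h≤1 = ≤-trans h≤a a≤1
      νkh≡b : fromℕ (suc i ℕ.* k) * h ≡ b
      νkh≡b = trans (cong (_* h) (fromℕ-* (suc i) k))
        (trans (solve 3 (λ ν k h → ν :* k :* h := ν :* h :* k) refl ν (fromℕ k) h) (cong (_* fromℕ k) νh≡a))
      fine : (1# - h) ^ (suc i ℕ.* k) ≤ exp (- b) + ν * fromℕ k * (h * h * exp b)
      fine = subst₂ (λ z j → (1# - h) ^ (suc i ℕ.* k) ≤ exp (- z) + j * (h * h * exp b)) νkh≡b (fromℕ-* (suc i) k)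
        (exp-backward-steps h (suc i ℕ.* k) 0≤h h≤1 (≤-reflexive νkh≡b))
      1-a≤[1-h]^ν : 1# - a ≤ (1# - h) ^ suc i
      1-a≤[1-h]^ν = subst (λ z → 1# - z ≤ (1# - h) ^ suc i) νh≡a (bernoulli (suc i) 0≤h h≤1)
      coarse : (1# - a) ^ k ≤ exp (- b) + ν * fromℕ k * (h * h * exp b)
      coarse = ≤-trans (^-monoˡ-≤ k (≤⇒0≤- a≤1) 1-a≤[1-h]^ν)
        (≤-trans (≤-reflexive (Exp.^-assocʳ semiring (1# - h) (suc i) k)) fine)

  -- The sign is read off from the power bound: for a natural number ν ≥ z, the quotient a = z/ν is
  -- at most 1, and `exp (- z)` lies above (1 - a)^ν ≥ 0.
  exp-neg-nonNeg : ∀ {z} → 0# ≤ z → 0# ≤ exp (- z)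
  exp-neg-nonNeg {z} 0≤z = ≤-trans (^-nonNeg (suc k) (≤⇒0≤- a≤1))
    (subst (λ x → (1# - a) ^ suc k ≤ exp (- x)) (trans (*-comm a ν) νa≡z) ([1-a]^k≤exp[-ak] (suc k) 0≤a a≤1))
    where
    k = proj₁ (archimedean z)
    ν = fromℕ (suc k)
    0<ν = 0<fromℕ-suc k
    a = z / ν
    νa≡z : ν * a ≡ z
    νa≡z = *-/-cancel z (<⇒≢0 0<ν)
    0≤a : 0# ≤ a
    0≤a = *-nonNeg 0≤z (proj₁ (⁻¹-pos 0<ν))
    a≤1 : a ≤ 1#
    a≤1 = *-cancelˡ-≤ 0<ν (subst₂ _≤_ (sym νa≡z) (sym (*-identityʳ ν))
      (≤-trans (proj₂ (archimedean z)) (fromℕ-mono-≤ (ℕₚ.n≤1+n k))))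

  -- A ratio r ≥ max (1 - a) 0 whose powers are dominated by the exponential: if a > 1,
  -- then r = 0 serves.
  exp-dominated-ratio : ∀ {a} → 0# ≤ a →
    ∃ λ r → 0# ≤ r × 1# - a ≤ r × (∀ k → r ^ k ≤ exp (- (a * fromℕ k)))
  exp-dominated-ratio {a} 0≤a with total a 1#
  ... | inj₁ a≤1 = 1# - a , ≤⇒0≤- a≤1 , ≤-refl , λ k → [1-a]^k≤exp[-ak] k 0≤a a≤1
  ... | inj₂ 1≤a = 0# , ≤-refl , ≤-by (≤⇒0≤- 1≤a) (solve 1 (λ a → a :- :1 := :0 :- (:1 :- a)) refl a) , powers
    where
    powers : ∀ k → 0# ^ k ≤ exp (- (a * fromℕ k))
    powers zero    = 1≤exp (≤-reflexive (solve 1 (λ a → :0 := :- (a :* :0)) refl a))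
    powers (suc k) = subst (_≤ exp (- (a * fromℕ (suc k)))) (sym (zeroˡ (0# ^ k)))
      (exp-neg-nonNeg (*-nonNeg 0≤a (fromℕ-nonNeg (suc k))))

-- Finite subsets and single-element swaps

x∉p∖x : ∀ {p : Subset n} {x} → x ∉ p ∖ x
x∉p∖x {p = _ ∷ p} {suc x} (there x∈) = x∉p∖x {p = p} x∈

p∖x⊆p : ∀ (p : Subset n) x → p ∖ x ⊆ p
p∖x⊆p p x = p─q⊆p p ⁅ x ⁆

x∈p∪⁅x⁆ : ∀ (p : Subset n) x → x ∈ p ∪ ⁅ x ⁆
x∈p∪⁅x⁆ p x = q⊆p∪q p ⁅ x ⁆ (x∈⁅x⁆ x)

z∈p∪⁅x⁆⁻ : ∀ {p : Subset n} {x z} → z ∈ p ∪ ⁅ x ⁆ → z ∈ p ⊎ z ≡ x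
z∈p∪⁅x⁆⁻ {p = p} {x} z∈ with x∈p∪q⁻ p ⁅ x ⁆ z∈
... | inj₁ z∈p   = inj₁ z∈p
... | inj₂ z∈⁅x⁆ = inj₂ (x∈⁅y⁆⇒x≡y x z∈⁅x⁆)

p∖x∪⁅x⁆≡p : ∀ {p : Subset n} {x} → x ∈ p → (p ∖ x) ∪ ⁅ x ⁆ ≡ p
p∖x∪⁅x⁆≡p {p = p} {x} x∈p = ⊆-antisym to from
  where
  to : (p ∖ x) ∪ ⁅ x ⁆ ⊆ p
  to z∈ with z∈p∪⁅x⁆⁻ z∈
  ... | inj₁ z∈p∖x = p∖x⊆p p x z∈p∖x
  ... | inj₂ refl  = x∈p
  from : p ⊆ (p ∖ x) ∪ ⁅ x ⁆
  from {z} z∈p with z Finₚ.≟ x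
  ... | yes refl = x∈p∪⁅x⁆ (p ∖ x) x
  ... | no z≢x   = p⊆p∪q ⁅ x ⁆ (x∈p∧x≢y⇒x∈p-y z∈p z≢x)

∣p∪⁅x⁆∣≡1+∣p∣ : ∀ {p : Subset n} {x} → x ∉ p → ∣ p ∪ ⁅ x ⁆ ∣ ≡ suc ∣ p ∣
∣p∪⁅x⁆∣≡1+∣p∣ {p = inside ∷ p}  {zero} x∉p = ⊥-elim (x∉p here)
∣p∪⁅x⁆∣≡1+∣p∣ {p = outside ∷ p} {zero} x∉p = cong (suc ∘ ∣_∣) (∪-identityʳ p)
∣p∪⁅x⁆∣≡1+∣p∣ {p = inside ∷ p}  {suc x} x∉p = cong suc (∣p∪⁅x⁆∣≡1+∣p∣ (x∉p ∘ there))
∣p∪⁅x⁆∣≡1+∣p∣ {p = outside ∷ p} {suc x} x∉p = ∣p∪⁅x⁆∣≡1+∣p∣ (x∉p ∘ there)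

∈-swap⁺ : ∀ {X : Subset n} {x y z} → z ∈ X → z ≢ x → z ∈ swap X x y
∈-swap⁺ {y = y} z∈X z≢x = p⊆p∪q ⁅ y ⁆ (x∈p∧x≢y⇒x∈p-y z∈X z≢x)

y∈swap : ∀ (X : Subset n) x y → y ∈ swap X x y
y∈swap X x y = x∈p∪⁅x⁆ (X ∖ x) y

∣swap∣≡∣X∣ : ∀ {X : Subset n} {x y} → x ∈ X → y ∉ X → ∣ swap X x y ∣ ≡ ∣ X ∣
∣swap∣≡∣X∣ {X = X} {x} {y} x∈X y∉X = begin
  ∣ (X ∖ x) ∪ ⁅ y ⁆ ∣   ≡⟨ ∣p∪⁅x⁆∣≡1+∣p∣ (y∉X ∘ p∖x⊆p X x) ⟩
  suc ∣ X ∖ x ∣         ≡⟨ ∣p∪⁅x⁆∣≡1+∣p∣ (x∉p∖x {p = X}) ⟨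
  ∣ (X ∖ x) ∪ ⁅ x ⁆ ∣   ≡⟨ cong ∣_∣ (p∖x∪⁅x⁆≡p x∈X) ⟩
  ∣ X ∣                 ∎
  where open ≡-Reasoning

p⊆q∧∣p∣≡∣q∣⇒q⊆p : ∀ {p q : Subset n} → p ⊆ q → ∣ p ∣ ≡ ∣ q ∣ → q ⊆ p
p⊆q∧∣p∣≡∣q∣⇒q⊆p {p = p} p⊆q ∣p∣≡∣q∣ {z} z∈q with z ∈? p
... | yes z∈p = z∈p
... | no z∉p  = ⊥-elim (ℕₚ.<-irrefl ∣p∣≡∣q∣ (p⊂q⇒∣p∣<∣q∣ (p⊆q , z , z∈q , z∉p)))

∣q∣≤∣p∣⇒∃∈p∉q : ∀ {p q : Subset n} {a} → a ∈ q → a ∉ p → ∣ q ∣ ℕ.≤ ∣ p ∣ → ∃ λ b → b ∈ p × b ∉ q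
∣q∣≤∣p∣⇒∃∈p∉q {p = p} {q} {a} a∈q a∉p ∣q∣≤∣p∣ with Finₚ.any? (λ b → b ∈? p ×-dec ¬? (b ∈? q))
... | yes found = found
... | no none   = ⊥-elim (ℕₚ.<⇒≱ (p⊂q⇒∣p∣<∣q∣ (p⊆q , a , a∈q , a∉p)) ∣q∣≤∣p∣)
  where
  p⊆q : p ⊆ q
  p⊆q {z} z∈p with z ∈? q
  ... | yes z∈q = z∈q
  ... | no z∉q  = ⊥-elim (none (z , z∈p , z∉q))

-- Basis exchange in a matroid

module MatroidProperties (𝓜 : Matroid n) where
  open Matroid 𝓜

  -- The deficit d drives the recursion. The inclusion in `Z ∪ Y` records that every new element
  -- comes from Y.
  augment-to-size : ∀ d {Z Y} → Indep Z → Indep Y → ∣ Z ∣ ℕ.+ d ≡ ∣ Y ∣ →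
    ∃ λ Z′ → Indep Z′ × Z ⊆ Z′ × Z′ ⊆ Z ∪ Y × ∣ Z′ ∣ ≡ ∣ Y ∣
  augment-to-size zero {Z} {Y} indZ _ eq =
    Z , indZ , ⊆-refl , p⊆p∪q Y , trans (sym (ℕₚ.+-identityʳ _)) eq
  augment-to-size (suc d) {Z} {Y} indZ indY eq
    with augmentation indZ indY (subst (∣ Z ∣ ℕ.<_) eq (ℕₚ.m<m+n ∣ Z ∣ (ℕ.s≤s ℕ.z≤n)))
  ... | y , y∈Y , y∉Z , ind with augment-to-size d ind indY
          (trans (cong (ℕ._+ d) (∣p∪⁅x⁆∣≡1+∣p∣ y∉Z)) (trans (sym (ℕₚ.+-suc ∣ Z ∣ d)) eq))
  ...   | Z′ , indZ′ , Z+y⊆Z′ , Z′⊆ , ∣Z′∣≡ = Z′ , indZ′ , Z+y⊆Z′ ∘ p⊆p∪q ⁅ y ⁆ , Z′⊆Z∪Y , ∣Z′∣≡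
    where
    Z′⊆Z∪Y : Z′ ⊆ Z ∪ Y
    Z′⊆Z∪Y z∈Z′ with x∈p∪q⁻ (Z ∪ ⁅ y ⁆) Y (Z′⊆ z∈Z′)
    ... | inj₂ z∈Y = q⊆p∪q Z Y z∈Y
    ... | inj₁ z∈Z+y with z∈p∪⁅x⁆⁻ z∈Z+y
    ...   | inj₁ z∈Z  = p⊆p∪q Y z∈Z
    ...   | inj₂ refl = q⊆p∪q Z Y y∈Y

  [X∩Y]∪⁅a⁆⊆X : ∀ {X Y : Subset n} {a} → a ∈ X → (X ∩ Y) ∪ ⁅ a ⁆ ⊆ X
  [X∩Y]∪⁅a⁆⊆X {X} {Y} a∈X z∈ with z∈p∪⁅x⁆⁻ z∈
  ... | inj₁ z∈X∩Y = p∩q⊆p X Y z∈X∩Y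
  ... | inj₂ refl  = a∈X

  opaque
    -- Extend (X ∩ Y) + a by elements of Y to the size of Y. The result contains a ∉ Y, so by
    -- counting it misses some b ∈ Y, and a second count identifies it with Y - b + a. Starting from
    -- X ∩ Y, and not from a alone, forces b ∉ X.
    exchange : ∀ {X Y a} → Indep X → Indep Y → ∣ X ∣ ≡ ∣ Y ∣ → a ∈ X → a ∉ Y →
      ∃ λ b → b ∈ Y × b ∉ X × Indep (swap Y b a)
    exchange {X} {Y} {a} indX indY ∣X∣≡∣Y∣ a∈X a∉Y
      with augment-to-size (∣ Y ∣ ℕ.∸ ∣ (X ∩ Y) ∪ ⁅ a ⁆ ∣) (hereditary ([X∩Y]∪⁅a⁆⊆X a∈X) indX) indY
             (ℕₚ.m+[n∸m]≡n (subst (∣ (X ∩ Y) ∪ ⁅ a ⁆ ∣ ℕ.≤_) ∣X∣≡∣Y∣ (p⊆q⇒∣p∣≤∣q∣ ([X∩Y]∪⁅a⁆⊆X a∈X))))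
    ... | Z , indZ , core⊆Z , Z⊆ , ∣Z∣≡∣Y∣
      with ∣q∣≤∣p∣⇒∃∈p∉q (core⊆Z (x∈p∪⁅x⁆ (X ∩ Y) a)) a∉Y (ℕₚ.≤-reflexive ∣Z∣≡∣Y∣)
    ...   | b , b∈Y , b∉Z = b , b∈Y , b∉X , hereditary swap⊆Z indZ
      where
      b∉X : b ∉ X
      b∉X b∈X = b∉Z (core⊆Z (p⊆p∪q ⁅ a ⁆ (x∈p∩q⁺ (b∈X , b∈Y))))
      Z⊆swap : Z ⊆ swap Y b a
      Z⊆swap {z} z∈Z with x∈p∪q⁻ ((X ∩ Y) ∪ ⁅ a ⁆) Y (Z⊆ z∈Z)
      ... | inj₂ z∈Y = ∈-swap⁺ z∈Y λ { refl → b∉Z z∈Z }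
      ... | inj₁ z∈core with z∈p∪⁅x⁆⁻ z∈core
      ...   | inj₁ z∈X∩Y = ∈-swap⁺ (p∩q⊆q X Y z∈X∩Y) λ { refl → b∉Z z∈Z }
      ...   | inj₂ refl  = y∈swap Y b a
      swap⊆Z : swap Y b a ⊆ Z
      swap⊆Z = p⊆q∧∣p∣≡∣q∣⇒q⊆p Z⊆swap (trans ∣Z∣≡∣Y∣ (sym (∣swap∣≡∣X∣ b∈Y a∉Y)))

-- Weights of subsets, and local versus global optimality of bases

module Weights (F : OrderedField) where
  open OrderedField F
  open OrderedFieldProperties F
  open Sum semiring public using (sum; sum-cong-≗; ∑-distrib-+; *-distribˡ-sum)

  restrict : Subset n → (Fin n → ℝ) → Fin n → ℝ
  restrict p ω i = if lookup p i then ω i else 0#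

  weight : Subset n → (Fin n → ℝ) → ℝ
  weight p ω = sum (restrict p ω)

  weight-∪⁅⁆ : ∀ {p : Subset n} {x} ω → x ∉ p → weight (p ∪ ⁅ x ⁆) ω ≡ weight p ω + ω x
  weight-∪⁅⁆ {p = inside ∷ p}  {zero} ω x∉p = ⊥-elim (x∉p here)
  weight-∪⁅⁆ {p = outside ∷ p} {zero} ω x∉p rewrite ∪-identityʳ p =
    solve 2 (λ a b → a :+ b := :0 :+ b :+ a) refl (ω zero) (weight p (ω ∘ suc))
  weight-∪⁅⁆ {p = inside ∷ p} {suc x} ω x∉p =
    trans (cong (ω zero +_) (weight-∪⁅⁆ (ω ∘ suc) (x∉p ∘ there))) (sym (+-assoc _ _ _))
  weight-∪⁅⁆ {p = outside ∷ p} {suc x} ω x∉p =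
    trans (cong (0# +_) (weight-∪⁅⁆ (ω ∘ suc) (x∉p ∘ there))) (sym (+-assoc _ _ _))

  weight-swap : ∀ {X : Subset n} {x y} ω → x ∈ X → y ∉ X →
    weight (swap X x y) ω + ω x ≡ weight X ω + ω y
  weight-swap {X = X} {x} {y} ω x∈X y∉X = begin
    weight (swap X x y) ω + ω x     ≡⟨ cong (_+ ω x) (weight-∪⁅⁆ ω (y∉X ∘ p∖x⊆p X x)) ⟩
    weight (X ∖ x) ω + ω y + ω x    ≡⟨ solve 3 (λ w a b → w :+ a :+ b := w :+ b :+ a)
        refl (weight (X ∖ x) ω) (ω y) (ω x) ⟩
    weight (X ∖ x) ω + ω x + ω y    ≡⟨ cong (_+ ω y) (weight-∪⁅⁆ ω (x∉p∖x {p = X})) ⟨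
    weight ((X ∖ x) ∪ ⁅ x ⁆) ω + ω y ≡⟨ cong (λ p → weight p ω + ω y) (p∖x∪⁅x⁆≡p x∈X) ⟩
    weight X ω + ω y                ∎
    where open ≡-Reasoning

  argMax : ∀ {n} (ω : Fin n → ℝ) {P : Fin n → Set} → Decidable P → ∃ P →
    ∃ λ i → P i × ∀ j → P j → ω j ≤ ω i
  argMax {suc n} ω {P} P? (k , Pk) with Finₚ.any? (P? ∘ suc)
  argMax {suc n} ω {P} P? (k , Pk) | no none = zero , P0 k Pk , only
    where
    P0 : ∀ k → P k → P zero
    P0 zero    Pk = Pk
    P0 (suc k) Pk = ⊥-elim (none (k , Pk))
    only : ∀ j → P j → ω j ≤ ω zero
    only zero    _  = ≤-refl
    only (suc j) Pj = ⊥-elim (none (j , Pj))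
  argMax {suc n} ω {P} P? _ | yes some with argMax (ω ∘ suc) (P? ∘ suc) some | P? zero
  ... | i , Pi , max | no ¬P0 = suc i , Pi , λ { zero P0 → ⊥-elim (¬P0 P0) ; (suc j) → max j }
  ... | i , Pi , max | yes P0 with total (ω zero) (ω (suc i))
  ...   | inj₁ ω0≤ωi = suc i , Pi , λ { zero _ → ω0≤ωi ; (suc j) → max j }
  ...   | inj₂ ωi≤ω0 = zero , P0 , λ { zero _ → ≤-refl ; (suc j) Pj → ≤-trans (max j Pj) ωi≤ω0 }

  -- A basis that is optimal among its neighbours has maximum weight: given a basis Y ≠ X,
  -- the heaviest x ∈ X ∖ Y is at least as heavy as whatever y ∈ Y ∖ X it replaces.
  module _ (𝓜 : Matroid n) where
    open Matroid 𝓜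
    open MatroidProperties 𝓜

    local⇒global : ∀ {X} ω → Indep X →
      (∀ {x y} → x ∈ X → y ∉ X → Indep (swap X x y) → ω y ≤ ω x) →
      ∀ {Y} → Indep Y → ∣ X ∣ ≡ ∣ Y ∣ → weight Y ω ≤ weight X ω
    local⇒global {X} ω indX local {Y} = go ∣ X ─ Y ∣ ℕₚ.≤-refl
      where
      go : ∀ d {Y} → ∣ X ─ Y ∣ ℕ.≤ d → Indep Y → ∣ X ∣ ≡ ∣ Y ∣ → weight Y ω ≤ weight X ω
      go d {Y} ∣X─Y∣≤d indY ∣X∣≡∣Y∣ with Finₚ.any? (λ x → x ∈? X ×-dec ¬? (x ∈? Y))
      ... | no none = ≤-reflexive (cong (λ p → weight p ω) (⊆-antisym (p⊆q∧∣p∣≡∣q∣⇒q⊆p X⊆Y ∣X∣≡∣Y∣) X⊆Y))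
        where
        X⊆Y : X ⊆ Y
        X⊆Y {x} x∈X with x ∈? Y
        ... | yes x∈Y = x∈Y
        ... | no x∉Y  = ⊥-elim (none (x , x∈X , x∉Y))
      ... | yes some with argMax ω (λ x → x ∈? X ×-dec ¬? (x ∈? Y)) some
      ...   | x , (x∈X , x∉Y) , x-max with exchange indX indY ∣X∣≡∣Y∣ x∈X x∉Y
      ...     | b , b∈Y , b∉X , indY′ = improve d ∣X─Y∣≤d
        where
        Y′ = swap Y b x
        -- A second exchange with the roles reversed inserts b into X and expels some x′ in X ─ Y.
        -- Local optimality gives ω b ≤ ω x′, and x was chosen heaviest so that x′ need not be x.
        ωb≤ωx : ω b ≤ ω x
        ωb≤ωx with exchange indY indX (sym ∣X∣≡∣Y∣) b∈Y b∉X
        ... | x′ , x′∈X , x′∉Y , ind = ≤-trans (local x′∈X b∉X ind) (x-max x′ (x′∈X , x′∉Y))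
        weightY≤weightY′ : weight Y ω ≤ weight Y′ ω
        weightY≤weightY′ = ≤-by (≤⇒0≤- ωb≤ωx) (begin
          ω x - ω b                                 ≡⟨ solve 3 (λ w a b → a :- b := (w :+ a) :- b :- w)
              refl (weight Y ω) (ω x) (ω b) ⟩
          (weight Y ω + ω x) - ω b - weight Y ω     ≡⟨ cong (λ s → s - ω b - weight Y ω) (weight-swap ω b∈Y x∉Y) ⟨
          (weight Y′ ω + ω b) - ω b - weight Y ω    ≡⟨ solve 3 (λ w b v → (w :+ b) :- b :- v := w :- v)
              refl (weight Y′ ω) (ω b) (weight Y ω) ⟩
          weight Y′ ω - weight Y ω                  ∎)
          where open ≡-Reasoning
        X─Y′⊂X─Y : X ─ Y′ ⊂ X ─ Y
        X─Y′⊂X─Y = X─Y′⊆X─Y , x , x∈p∧x∉q⇒x∈p─q x∈X x∉Y , λ x∈ → z∈p─q⇒z∉q x∈ (y∈swap Y b x)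
          where
          z∈p─q⇒z∉q : ∀ {m} {p q : Subset m} {z} → z ∈ p ─ q → z ∉ q
          z∈p─q⇒z∉q {p = _ ∷ p} {q = inside ∷ q}  (there z∈) (there z∈q) = z∈p─q⇒z∉q {p = p} z∈ z∈q
          z∈p─q⇒z∉q {p = _ ∷ p} {q = outside ∷ q} (there z∈) (there z∈q) = z∈p─q⇒z∉q {p = p} z∈ z∈q
          X─Y′⊆X─Y : X ─ Y′ ⊆ X ─ Y
          X─Y′⊆X─Y {z} z∈ = x∈p∧x∉q⇒x∈p─q z∈X z∉Y
            where
            z∈X = p─q⊆p X Y′ z∈
            z∉Y : z ∉ Y
            z∉Y z∈Y = z∈p─q⇒z∉q z∈ (∈-swap⁺ z∈Y λ { refl → b∉X z∈X })
        improve : ∀ d → ∣ X ─ Y ∣ ℕ.≤ d → weight Y ω ≤ weight X ω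
        improve zero    ∣X─Y∣≤0 = ⊥-elim (ℕₚ.n≮0 (ℕₚ.<-≤-trans (p⊂q⇒∣p∣<∣q∣ X─Y′⊂X─Y) ∣X─Y∣≤0))
        improve (suc d) ∣X─Y∣≤d = ≤-trans weightY≤weightY′
          (go d (ℕₚ.≤-pred (ℕₚ.<-≤-trans (p⊂q⇒∣p∣<∣q∣ X─Y′⊂X─Y) ∣X─Y∣≤d)) indY′
            (trans ∣X∣≡∣Y∣ (sym (∣swap∣≡∣X∣ b∈Y x∉Y))))

∣p∪q∣≤∣p∣+∣q∣ : ∀ (p q : Subset n) → ∣ p ∪ q ∣ ℕ.≤ ∣ p ∣ ℕ.+ ∣ q ∣
∣p∪q∣≤∣p∣+∣q∣ []            []            = ℕ.z≤n
∣p∪q∣≤∣p∣+∣q∣ (outside ∷ p) (outside ∷ q) = ∣p∪q∣≤∣p∣+∣q∣ p q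
∣p∪q∣≤∣p∣+∣q∣ (outside ∷ p) (inside ∷ q)  =
  subst (suc ∣ p ∪ q ∣ ℕ.≤_) (sym (ℕₚ.+-suc ∣ p ∣ ∣ q ∣)) (ℕ.s≤s (∣p∪q∣≤∣p∣+∣q∣ p q))
∣p∪q∣≤∣p∣+∣q∣ (inside ∷ p)  (outside ∷ q) = ℕ.s≤s (∣p∪q∣≤∣p∣+∣q∣ p q)
∣p∪q∣≤∣p∣+∣q∣ (inside ∷ p)  (inside ∷ q)  =
  ℕ.s≤s (ℕₚ.≤-trans (∣p∪q∣≤∣p∣+∣q∣ p q) (ℕₚ.+-monoʳ-≤ ∣ p ∣ (ℕₚ.n≤1+n ∣ q ∣)))

-- Sums over coordinates

module Sums (F : OrderedField) where
  open OrderedField F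
  open OrderedFieldProperties F
  open Weights F

  sum-mono-≤ : ∀ {n} {h k : Fin n → ℝ} → (∀ i → h i ≤ k i) → sum h ≤ sum k
  sum-mono-≤ {zero}  h≤k = ≤-refl
  sum-mono-≤ {suc n} h≤k = +-mono-≤ (h≤k zero) (sum-mono-≤ (h≤k ∘ suc))

  -- The shape is that of `quadratic-bound`: restricted weights in the bracket, squares of the
  -- coordinates in the last summand.
  sum-linear : ∀ {n} c d (h k l o : Fin n → ℝ) →
    sum (λ i → c * ((h i + k i) - l i) + d * o i) ≡ c * ((sum h + sum k) - sum l) + d * sum o
  sum-linear {zero}  c d h k l o = solve 2 (λ c d → :0 := c :* ((:0 :+ :0) :- :0) :+ d :* :0) refl c d
  sum-linear {suc n} c d h k l o = trans
    (cong (c * ((h zero + k zero) - l zero) + d * o zero +_) (sum-linear c d (h ∘ suc) (k ∘ suc) (l ∘ suc) (o ∘ suc)))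
    (solve 10 (λ c d h k l o H K L O →
        (c :* ((h :+ k) :- l) :+ d :* o) :+ (c :* ((H :+ K) :- L) :+ d :* O)
        := c :* (((h :+ H) :+ (k :+ K)) :- (l :+ L)) :+ d :* (o :+ O)) refl
      c d (h zero) (k zero) (l zero) (o zero) (sum (h ∘ suc)) (sum (k ∘ suc)) (sum (l ∘ suc)) (sum (o ∘ suc)))

  weight-const : ∀ (p : Subset n) c → weight p (const c) ≡ fromℕ ∣ p ∣ * c
  weight-const []            c = sym (zeroˡ c)
  weight-const (inside ∷ p)  c = trans (cong (c +_) (weight-const p c))
    (solve 2 (λ k c → c :+ k :* c := (:1 :+ k) :* c) refl (fromℕ ∣ p ∣) c)
  weight-const (outside ∷ p) c = trans (+-identityˡ _) (weight-const p c)

  weight-⊥ : ∀ (ω : Fin n → ℝ) → weight ⊥ ω ≡ 0#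
  weight-⊥ {zero}  ω = refl
  weight-⊥ {suc n} ω = trans (+-identityˡ _) (weight-⊥ (ω ∘ suc))

  weight-⁅⁆ : ∀ (x : Fin n) ω → weight ⁅ x ⁆ ω ≡ ω x
  weight-⁅⁆ zero    ω = trans (cong (ω zero +_) (weight-⊥ (ω ∘ suc))) (+-identityʳ _)
  weight-⁅⁆ (suc x) ω = trans (+-identityˡ _) (weight-⁅⁆ x (ω ∘ suc))

  sum≡weight : ∀ {p : Subset n} {ω} → (∀ i → i ∉ p → ω i ≡ 0#) → sum ω ≡ weight p ω
  sum≡weight {p = p} {ω} ω≡0 = sum-cong-≗ pointwise
    where
    pointwise : ∀ i → ω i ≡ restrict p ω i
    pointwise i with lookup p i in eq
    ... | inside  = refl
    ... | outside = ω≡0 i λ i∈p → outside≢inside (trans (sym eq) (Vecₚ.[]=⇒lookup i∈p))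
      where
      outside≢inside : outside ≢ inside
      outside≢inside ()

-- Strong concavity and smoothness as coordinatewise quadratic models

module QuadraticModel (R : Reals) where
  open Reals R
  open OrderedFieldProperties orderedField
  open Weights orderedField
  open Sums orderedField
  open Analysis R

  ⟨⟩≡sum : ∀ (x y : ℝ^ n) → ⟨ x , y ⟩ ≡ sum (λ i → lookup x i * lookup y i)
  ⟨⟩≡sum []      []      = refl
  ⟨⟩≡sum (a ∷ x) (b ∷ y) = cong (a * b +_) (⟨⟩≡sum x y)

  lookup-ᵥ : ∀ (x y : ℝ^ n) i → lookup (x -ᵥ y) i ≡ lookup x i - lookup y i
  lookup-ᵥ x y i = Vecₚ.lookup-zipWith _-_ i x y

  ∉supp⇒≡0 : ∀ {x : ℝ^ n} {i} → i ∉ supp x → lookup x i ≡ 0#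
  ∉supp⇒≡0 {x = x} {i} i∉ with lookup x i ≟ 0# in eq
  ... | yes x≡0 = x≡0
  ... | no _ = ⊥-elim (i∉ (Vecₚ.lookup⇒[]= i (supp x)
    (trans (Vecₚ.lookup-map i _ x) (cong (not ∘ does) eq))))

  ∈supp⇒≢0 : ∀ {x : ℝ^ n} {i} → i ∈ supp x → lookup x i ≢ 0#
  ∈supp⇒≢0 {x = x} {i} i∈ x≡0 with lookup x i ≟ 0# | trans (sym (Vecₚ.lookup-map i _ x)) (Vecₚ.[]=⇒lookup i∈)
  ... | yes _  | ()
  ... | no x≢0 | _ = x≢0 x≡0

  supp⊆⇒≡0 : ∀ {x : ℝ^ n} {X i} → supp x ⊆ X → i ∉ X → lookup x i ≡ 0#
  supp⊆⇒≡0 x⊆X i∉X = ∉supp⇒≡0 (i∉X ∘ x⊆X)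

  ≡0⇒supp⊆ : ∀ {x : ℝ^ n} {X} → (∀ i → i ∉ X → lookup x i ≡ 0#) → supp x ⊆ X
  ≡0⇒supp⊆ {X = X} x≡0 {i} i∈ with i ∈? X
  ... | yes i∈X = i∈X
  ... | no i∉X  = ⊥-elim (∈supp⇒≢0 i∈ (x≡0 i i∉X))

  lookup-𝟎 : ∀ (i : Fin n) → lookup 𝟎 i ≡ 0#
  lookup-𝟎 i = Vecₚ.lookup-replicate i 0#

  supp-𝟎⊆ : ∀ {X : Subset n} → supp 𝟎 ⊆ X
  supp-𝟎⊆ = ≡0⇒supp⊆ λ i _ → lookup-𝟎 i

  supp-ᵥ⊆ : ∀ {x y : ℝ^ n} {p} → (∀ i → i ∉ p → lookup x i ≡ lookup y i) → supp (x -ᵥ y) ⊆ p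
  supp-ᵥ⊆ {x = x} {y} x≡y = ≡0⇒supp⊆ λ i i∉p → trans (lookup-ᵥ x y i)
    (trans (cong (_- lookup y i) (x≡y i i∉p)) (-‿inverseʳ _))

  supp⊆⇒‖‖₀≤ : ∀ {x : ℝ^ n} {X k} → supp x ⊆ X → ∣ X ∣ ℕ.≤ k → ‖ x ‖₀ ℕ.≤ k
  supp⊆⇒‖‖₀≤ x⊆X = ℕₚ.≤-trans (p⊆q⇒∣p∣≤∣q∣ x⊆X)

  -- This is one coordinate of twice the quadratic model of u(y) - u(x) with gradient g and
  -- curvature c. Doubling clears the halves in the definitions of strong concavity and smoothness.
  quadratic : ℝ^ n → ℝ → ℝ^ n → ℝ^ n → Fin n → ℝ
  quadratic g c x y i = 2# * (lookup g i * d) - c * (d * d)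
    where d = lookup y i - lookup x i

  sum-quadratic : ∀ (g : ℝ^ n) c x y →
    sum (quadratic g c x y) ≡ 2# * ⟨ g , y -ᵥ x ⟩ - c * ‖ y -ᵥ x ‖²
  sum-quadratic []      c []      []      = solve 1 (λ c → :0 := :2 :* :0 :- c :* :0) refl c
  sum-quadratic (g ∷ gs) c (x ∷ xs) (y ∷ ys) = trans
    (cong (2# * (g * (y - x)) - c * ((y - x) * (y - x)) +_) (sum-quadratic gs c xs ys))
    (solve 5 (λ g d c G D → (:2 :* (g :* d) :- c :* (d :* d)) :+ (:2 :* G :- c :* D)
        := :2 :* (g :* d :+ G) :- c :* (d :* d :+ D)) refl
      g (y - x) c ⟨ gs , ys -ᵥ xs ⟩ ‖ ys -ᵥ xs ‖²)

  sum-quadratic≡weight : ∀ {p : Subset n} g c {x y} → (∀ i → i ∉ p → lookup y i ≡ lookup x i) →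
    sum (quadratic g c x y) ≡ weight p (quadratic g c x y)
  sum-quadratic≡weight g c {x} {y} y≡x = sum≡weight λ i i∉p →
    trans (cong (λ b → 2# * (lookup g i * (b - lookup x i)) - c * ((b - lookup x i) * (b - lookup x i))) (y≡x i i∉p))
      (solve 3 (λ g a c → :2 :* (g :* (a :- a)) :- c :* ((a :- a) :* (a :- a)) := :0)
          refl (lookup g i) (lookup x i) c)

  private
    2≢0 : 2# ≢ 0#
    2≢0 = <⇒≢0 (0<fromℕ-suc 1)

    halve : ∀ c D → 2# * (- (c / 2#) * D) ≡ - (c * D)
    halve c D = trans (solve 2 (λ h D → :2 :* (:- h :* D) := :- (:2 :* h :* D)) refl (c / 2#) D)
      (cong (λ z → - (z * D)) (*-/-cancel c 2≢0))

  module _ {u : ℝ^ n → ℝ} {∇u : ℝ^ n → ℝ^ n} where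

    concave-≤ : ∀ {Ω m} → RestrictedStronglyConcave u ∇u Ω m → ∀ {x y} → Ω x y →
      2# * (u y - u x) ≤ sum (quadratic (∇u x) m x y)
    concave-≤ {m = m} concave {x} {y} Ωxy = subst (2# * (u y - u x) ≤_) (sym (sum-quadratic (∇u x) m x y))
      (≤-by (≤⇒0≤- (*-monoˡ-≤ 2# (fromℕ-nonNeg 2) (concave x y Ωxy))) (begin
        2# * (- (m / 2#) * D) - 2# * (δ - G)   ≡⟨ cong (_- 2# * (δ - G)) (halve m D) ⟩
        - (m * D) - 2# * (δ - G)               ≡⟨ solve 4 (λ m D δ G → :- (m :* D) :- :2 :* (δ :- G)
              := (:2 :* G :- m :* D) :- :2 :* δ)
            refl m D δ G ⟩
        (2# * G - m * D) - 2# * δ              ∎))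
      where
      open ≡-Reasoning
      δ = u y - u x
      G = ⟨ ∇u x , y -ᵥ x ⟩
      D = ‖ y -ᵥ x ‖²

    smooth-≥ : ∀ {Ω M} → RestrictedSmooth u ∇u Ω M → ∀ {x y} → Ω x y →
      sum (quadratic (∇u x) M x y) ≤ 2# * (u y - u x)
    smooth-≥ {M = M} smooth {x} {y} Ωxy = subst (_≤ 2# * (u y - u x)) (sym (sum-quadratic (∇u x) M x y))
      (≤-by (≤⇒0≤- (*-monoˡ-≤ 2# (fromℕ-nonNeg 2) (smooth x y Ωxy))) (begin
        2# * (δ - G) - 2# * (- (M / 2#) * D)   ≡⟨ cong (λ z → 2# * (δ - G) - z) (halve M D) ⟩
        2# * (δ - G) - - (M * D)               ≡⟨ solve 4 (λ m D δ G → :2 :* (δ :- G) :- :- (m :* D)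
              := :2 :* δ :- (:2 :* G :- m :* D))
            refl M D δ G ⟩
        2# * δ - (2# * G - M * D)              ∎))
      where
      open ≡-Reasoning
      δ = u y - u x
      G = ⟨ ∇u x , y -ᵥ x ⟩
      D = ‖ y -ᵥ x ‖²

-- Coordinatewise comparison of a solution with a competitor

module CoordinateBounds (F : OrderedField) where
  open OrderedField F
  open OrderedFieldProperties F

  -- One coordinate of the comparison of a solution w on X with a competitor v on Y: a and c
  -- are its weights in Y and in X, and b is the cost of the coordinate of Y.
  Bounded : (q m M g w v a b c : ℝ) → Set
  Bounded q m M g w v a b c =
    2# * (g * (v - w)) - m * ((v - w) * (v - w)) ≤ q * ((a + b) - c) + (q * M - m) * (w * w)

  bounded-both : ∀ {q m M g w v a b c} → 0# ≤ q → 0# ≤ m → 0# ≤ q * M - m →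
    g ≡ 0# → a ≡ c → 0# ≤ b → Bounded q m M g w v a b c
  bounded-both {q} {m} {M} {_} {w} {v} {a} {b} 0≤q 0≤m 0≤δ refl refl 0≤b =
    ≤-by (+-nonNeg (+-nonNeg (*-nonNeg 0≤q 0≤b) (*-nonNeg 0≤δ (0≤x*x w))) (*-nonNeg 0≤m (0≤x*x (v - w))))
      (solve 7 (λ q b M w m v a →
        q :* b :+ (q :* M :- m) :* (w :* w) :+ m :* ((v :- w) :* (v :- w))
        := (q :* ((a :+ b) :- a) :+ (q :* M :- m) :* (w :* w)) :- (:2 :* (:0 :* (v :- w)) :- m :* ((v :- w) :* (v :- w))))
        refl q b M w m v a)

  -- Equality holds here, and this case dictates the coefficient qM - m: the model loses m w², while
  -- the weight charges q M w².
  bounded-X : ∀ {q m M g w v a b c} → g ≡ 0# → v ≡ 0# → a ≡ 0# → b ≡ 0# → c ≡ M * (w * w) →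
    Bounded q m M g w v a b c
  bounded-X {q} {m} {M} {_} {w} refl refl refl refl refl =
    ≤-reflexive (solve 4 (λ q M w m →
      :2 :* (:0 :* (:0 :- w)) :- m :* ((:0 :- w) :* (:0 :- w))
      := q :* ((:0 :+ :0) :- M :* (w :* w)) :+ (q :* M :- m) :* (w :* w)) refl q M w m)

  -- Completing the square: 2gv - m v² is largest at v = g/m = q t, with value g²/m = q g t. The
  -- difference of the two sides is m (v - q t)².
  bounded-Y : ∀ {q m M g t w v a b c} → 0# ≤ m → M ≡ q * m → g ≡ M * t →
    w ≡ 0# → a ≡ g * t - b → c ≡ 0# → Bounded q m M g w v a b c
  bounded-Y {q} {m} {t = t} {v = v} {b = b} 0≤m refl refl refl refl refl =
    ≤-by (*-nonNeg 0≤m (0≤x*x (v - q * t)))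
      (solve 5 (λ q m t v b →
        m :* ((v :- q :* t) :* (v :- q :* t))
        := (q :* ((q :* m :* t :* t :- b :+ b) :- :0) :+ (q :* (q :* m) :- m) :* (:0 :* :0))
           :- (:2 :* (q :* m :* t :* (v :- :0)) :- m :* ((v :- :0) :* (v :- :0)))) refl q m t v b)

  bounded-neither : ∀ {q m M g w v a b c} → w ≡ 0# → v ≡ 0# → a ≡ 0# → b ≡ 0# → c ≡ 0# →
    Bounded q m M g w v a b c
  bounded-neither {q} {m} {M} {g} refl refl refl refl refl =
    ≤-reflexive (solve 4 (λ q M m g →
      :2 :* (g :* (:0 :- :0)) :- m :* ((:0 :- :0) :* (:0 :- :0))
      := q :* ((:0 :+ :0) :- :0) :+ (q :* M :- m) :* (:0 :* :0)) refl q M m g)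

  -- As M = q m, the coefficient qM - m equals (q² - 1) m, so the last summand is at most 2(q² - 1)
  -- f. Adding the 2f from the left side gives 2q² f.
  combine-bounds : ∀ {q m M f f* G S W W* N} → M ≡ q * m → 0# ≤ q → 0# ≤ q * q - 1# →
    2# * (f* - f) ≤ q * ((W* + S * (2# * G)) - W) + (q * M - m) * N →
    W* ≤ W → m * N ≤ 2# * f → f* ≤ q * S * G + q * q * f
  combine-bounds {q} {m} {_} {f} {f*} {G} {S} {W} {W*} {N} refl 0≤q 1≤q² bound W*≤W mN≤2f =
    *-cancelˡ-≤ (0<fromℕ-suc 1)
      (≤-by (+-nonNeg (+-nonNeg (≤⇒0≤- bound) (*-nonNeg 0≤q (≤⇒0≤- W*≤W))) (*-nonNeg 1≤q² (≤⇒0≤- mN≤2f)))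
        (solve 9 (λ q m f f* G S W W* N →
          (q :* ((W* :+ S :* (:2 :* G)) :- W) :+ (q :* (q :* m) :- m) :* N :- :2 :* (f* :- f)) :+ q :* (W :- W*)
            :+ (q :* q :- :1) :* (:2 :* f :- m :* N)
          := :2 :* (q :* S :* G :+ q :* q :* f) :- :2 :* f*) refl q m f f* G S W W* N))

-- From swap scores to a comparison of function values

module Localizability (R : Reals) where
  open Reals R
  open OrderedFieldProperties orderedField
  open Weights orderedField
  open Sums orderedField
  open Analysis R
  open QuadraticModel R
  open CoordinateBounds orderedField

  module _ {n} {s} (1≤s : 1 ℕ.≤ s) (u : ℝ^ n → ℝ) (∇u : ℝ^ n → ℝ^ n) (0≤u𝟎 : 0# ≤ u 𝟎)
           {m M} (0<m : 0# < m) (0<M : 0# < M)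
           (concave : RestrictedStronglyConcave u ∇u (Ω₁ (2 ℕ.* s)) m)
           (smooth : RestrictedSmooth u ∇u (Ω₂ s 2) M)
           (attained : MaximaAttained u) where
    open Maxima attained

    concave-on : ∀ {X Y x y} → ∣ X ∣ ℕ.≤ s → ∣ Y ∣ ℕ.≤ s → supp x ⊆ X → supp y ⊆ Y →
      2# * (u y - u x) ≤ sum (quadratic (∇u x) m x y)
    concave-on {X} {Y} {x} {y} ∣X∣≤s ∣Y∣≤s x⊆X y⊆Y = concave-≤ {u = u} {∇u} {Ω₁ (2 ℕ.* s)} {m} concave
      ( supp⊆⇒‖‖₀≤ {x = x} x⊆X (ℕₚ.≤-trans ∣X∣≤s s≤2s)
      , supp⊆⇒‖‖₀≤ {x = y} y⊆Y (ℕₚ.≤-trans ∣Y∣≤s s≤2s)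
      , supp⊆⇒‖‖₀≤ {x = x -ᵥ y} (supp-ᵥ⊆ {x = x} {y} {X ∪ Y} x≡y) (ℕₚ.≤-trans (∣p∪q∣≤∣p∣+∣q∣ X Y)
          (ℕₚ.+-mono-≤ ∣X∣≤s (ℕₚ.≤-trans ∣Y∣≤s (ℕₚ.m≤m+n s 0)))))
      where
      s≤2s : s ℕ.≤ 2 ℕ.* s
      s≤2s = ℕₚ.m≤m+n s (s ℕ.+ 0)
      x≡y : ∀ i → i ∉ X ∪ Y → lookup x i ≡ lookup y i
      x≡y i i∉ = trans (supp⊆⇒≡0 x⊆X (i∉ ∘ p⊆p∪q Y)) (sym (supp⊆⇒≡0 y⊆Y (i∉ ∘ q⊆p∪q X Y)))

    smooth-on : ∀ {X Y x y p} → ∣ X ∣ ℕ.≤ s → ∣ Y ∣ ℕ.≤ s → supp x ⊆ X → supp y ⊆ Y →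
      ∣ p ∣ ℕ.≤ 2 → (∀ i → i ∉ p → lookup y i ≡ lookup x i) →
      weight p (quadratic (∇u x) M x y) ≤ 2# * (u y - u x)
    smooth-on {x = x} {y} {p} ∣X∣≤s ∣Y∣≤s x⊆X y⊆Y ∣p∣≤2 y≡x =
      subst (_≤ 2# * (u y - u x)) (sum-quadratic≡weight (∇u x) M {x} {y} y≡x) (smooth-≥ {u = u} {∇u} {Ω₂ s 2} {M} smooth
        ( supp⊆⇒‖‖₀≤ {x = x} x⊆X ∣X∣≤s , supp⊆⇒‖‖₀≤ {x = y} y⊆Y ∣Y∣≤s
        , supp⊆⇒‖‖₀≤ {x = x -ᵥ y} (supp-ᵥ⊆ {x = x} {y} {p} (λ i i∉p → sym (y≡x i i∉p))) ∣p∣≤2))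

    ∣⁅x⁆∣≤ : ∀ (i : Fin n) {k} → 1 ℕ.≤ k → ∣ ⁅ i ⁆ ∣ ℕ.≤ k
    ∣⁅x⁆∣≤ i = ℕₚ.≤-trans (ℕₚ.≤-reflexive (∣⁅x⁆∣≡1 i))

    update-≡ : ∀ (x : ℝ^ n) i a j → j ∉ ⁅ i ⁆ → lookup (x [ i ]≔ a) j ≡ lookup x j
    update-≡ x i a j j∉ = Vecₚ.lookup∘update′ (x∉⁅y⁆⇒x≢y j∉) x a

    -- For a unit step from the origin both models bracket the same increment of u and share their
    -- linear term, so only the curvatures remain to be compared. The index i supplies the nonzero
    -- direction, and s ≥ 1 keeps the step in both domains.
    m≤M : Fin n → m ≤ M
    m≤M i = ≤-by (≤⇒0≤- (≤-trans M-side m-side))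
        (solve 3 (λ g m M → (:2 :* (g :* :1) :- m :* (:1 :* :1)) :- (:2 :* (g :* :1) :- M :* (:1 :* :1)) := M :- m)
          refl (lookup (∇u 𝟎) i) m M)
      where
      e : ℝ^ n
      e = 𝟎 [ i ]≔ 1#
      e≡𝟎 : ∀ j → j ∉ ⁅ i ⁆ → lookup e j ≡ lookup 𝟎 j
      e≡𝟎 = update-≡ 𝟎 i 1#
      e⊆ : supp e ⊆ ⁅ i ⁆
      e⊆ = ≡0⇒supp⊆ λ j j∉ → trans (e≡𝟎 j j∉) (lookup-𝟎 j)
      value : ∀ c → weight ⁅ i ⁆ (quadratic (∇u 𝟎) c 𝟎 e) ≡ 2# * (lookup (∇u 𝟎) i * 1#) - c * (1# * 1#)
      value c = trans (weight-⁅⁆ i _) (cong (λ d → 2# * (lookup (∇u 𝟎) i * d) - c * (d * d))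
        (trans (cong₂ _-_ (Vecₚ.lookup∘update i 𝟎 1#) (lookup-𝟎 i)) (solve 0 (:1 :- :0 := :1) refl)))
      M-side : 2# * (lookup (∇u 𝟎) i * 1#) - M * (1# * 1#) ≤ 2# * (u e - u 𝟎)
      M-side = subst (_≤ 2# * (u e - u 𝟎)) (value M)
        (smooth-on (∣⁅x⁆∣≤ i 1≤s) (∣⁅x⁆∣≤ i 1≤s) (supp-𝟎⊆ {X = ⁅ i ⁆}) e⊆ (∣⁅x⁆∣≤ i (ℕ.s≤s ℕ.z≤n)) e≡𝟎)
      m-side : 2# * (u e - u 𝟎) ≤ 2# * (lookup (∇u 𝟎) i * 1#) - m * (1# * 1#)
      m-side = subst (2# * (u e - u 𝟎) ≤_) (trans (sum-quadratic≡weight (∇u 𝟎) m {𝟎} {e} e≡𝟎) (value m))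
        (concave-on (∣⁅x⁆∣≤ i 1≤s) (∣⁅x⁆∣≤ i 1≤s) (supp-𝟎⊆ {X = ⁅ i ⁆}) e⊆)

    0≤f : ∀ X → 0# ≤ f X
    0≤f X = ≤-trans 0≤u𝟎 (proj₂ (proj₂ (attained X)) 𝟎 supp-𝟎⊆)

    module AtSolution (X : Subset n) (∣X∣≤s : ∣ X ∣ ℕ.≤ s) where

      w g : Fin n → ℝ
      w = lookup (𝐰 X)
      g = lookup (∇u (𝐰 X))

      -- The gradient step of size 1/M in one coordinate.
      t : Fin n → ℝ
      t i = g i / M

      Mt≡g : ∀ i → M * t i ≡ g i
      Mt≡g i = *-/-cancel (g i) (<⇒≢0 0<M)

      w⊆X : supp (𝐰 X) ⊆ X
      w⊆X = proj₁ (proj₂ (attained X))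

      w≡0 : ∀ {i} → i ∉ X → w i ≡ 0#
      w≡0 = supp⊆⇒≡0 w⊆X

      -- A gradient step in coordinate i keeps the support inside X and raises 2u by at least M (t
      -- i)². Maximality of `𝐰 X` leaves only t i = 0.
      g≡0 : ∀ {i} → i ∈ X → g i ≡ 0#
      g≡0 {i} i∈X with t i ≟ 0#
      ... | yes t≡0 = trans (sym (Mt≡g i)) (trans (cong (M *_) t≡0) (zeroʳ M))
      ... | no t≢0  = ⊥-elim (t≢0 (*-cancelˡ-≡ t≢0 (trans (≤-antisym t*t≤0 (0≤x*x (t i))) (sym (zeroʳ (t i))))))
        where
        z : ℝ^ n
        z = 𝐰 X [ i ]≔ (w i + t i)
        z≡w : ∀ j → j ∉ ⁅ i ⁆ → lookup z j ≡ w j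
        z≡w = update-≡ (𝐰 X) i (w i + t i)
        z⊆X : supp z ⊆ X
        z⊆X = ≡0⇒supp⊆ λ j j∉X → trans (z≡w j (λ j∈ → j∉X (subst (_∈ X) (sym (x∈⁅y⁆⇒x≡y i j∈)) i∈X))) (w≡0 j∉X)
        value : weight ⁅ i ⁆ (quadratic (∇u (𝐰 X)) M (𝐰 X) z) ≡ M * (t i * t i)
        value = begin
          weight ⁅ i ⁆ (quadratic (∇u (𝐰 X)) M (𝐰 X) z)  ≡⟨ weight-⁅⁆ i _ ⟩
          quadratic (∇u (𝐰 X)) M (𝐰 X) z i
            ≡⟨ cong (λ b → 2# * (g i * (b - w i)) - M * ((b - w i) * (b - w i))) (Vecₚ.lookup∘update i (𝐰 X) (w i + t i)) ⟩
          2# * (g i * (w i + t i - w i)) - M * ((w i + t i - w i) * (w i + t i - w i))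
            ≡⟨ cong (λ γ → 2# * (γ * (w i + t i - w i)) - M * ((w i + t i - w i) * (w i + t i - w i))) (sym (Mt≡g i)) ⟩
          2# * (M * t i * (w i + t i - w i)) - M * ((w i + t i - w i) * (w i + t i - w i))
            ≡⟨ solve 3 (λ M t w → :2 :* (M :* t :* (w :+ t :- w)) :- M :* ((w :+ t :- w) :* (w :+ t :- w))
                  := M :* (t :* t))
                refl M (t i) (w i) ⟩
          M * (t i * t i) ∎
          where open ≡-Reasoning
        uz≤uw : u z ≤ u (𝐰 X)
        uz≤uw = proj₂ (proj₂ (attained X)) z z⊆X
        Mtt≤0 : M * (t i * t i) ≤ 2# * (u z - u (𝐰 X))
        Mtt≤0 = subst (_≤ 2# * (u z - u (𝐰 X))) value
          (smooth-on ∣X∣≤s ∣X∣≤s w⊆X z⊆X (∣⁅x⁆∣≤ i (ℕ.s≤s ℕ.z≤n)) z≡w)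
        t*t≤0 : t i * t i ≤ 0#
        t*t≤0 = *-cancelˡ-≤ 0<M (≤-trans Mtt≤0
          (≤-by (*-nonNeg (fromℕ-nonNeg 2) (≤⇒0≤- uz≤uw))
            (solve 3 (λ M a b → :2 :* (b :- a) := M :* :0 :- :2 :* (a :- b)) refl M (u z) (u (𝐰 X)))))

      -- The product `g y * t y` is g_y²/M; the whole is twice the guaranteed gain, again to avoid
      -- halves.
      score : Fin n → Fin n → ℝ
      score x y = g y * t y - M * (w x * w x)

      -- The test point z sets coordinate x of `𝐰 X` to zero and gives y a gradient step. Only two
      -- coordinates change, so smoothness on `Ω₂ s 2` applies; dropping x has no linear term
      -- because g x = 0. The maximum over the swapped set is at least u z.
      score≤2gain : ∀ {x y} → x ∈ X → y ∉ X → score x y ≤ 2# * (f (swap X x y) - f X)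
      score≤2gain {x} {y} x∈X y∉X = ≤-trans (subst (_≤ 2# * (u z - u (𝐰 X))) value
          (smooth-on ∣X∣≤s (subst (ℕ._≤ s) (sym (∣swap∣≡∣X∣ x∈X y∉X)) ∣X∣≤s) w⊆X z⊆swap
            (ℕₚ.≤-reflexive (trans (∣p∪⁅x⁆∣≡1+∣p∣ y∉⁅x⁆) (cong suc (∣⁅x⁆∣≡1 x)))) z≡w))
        (*-monoˡ-≤ 2# (fromℕ-nonNeg 2) (+-monoˡ-≤ (- f X) (proj₂ (proj₂ (attained (swap X x y))) z z⊆swap)))
        where
        x≢y : x ≢ y
        x≢y refl = y∉X x∈X
        y∉⁅x⁆ : y ∉ ⁅ x ⁆
        y∉⁅x⁆ = x≢y⇒x∉⁅y⁆ (x≢y ∘ sym)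
        z : ℝ^ n
        z = (𝐰 X [ x ]≔ 0#) [ y ]≔ t y
        z≡w : ∀ j → j ∉ ⁅ x ⁆ ∪ ⁅ y ⁆ → lookup z j ≡ w j
        z≡w j j∉ = trans (update-≡ (𝐰 X [ x ]≔ 0#) y (t y) j (j∉ ∘ q⊆p∪q ⁅ x ⁆ ⁅ y ⁆))
          (update-≡ (𝐰 X) x 0# j (j∉ ∘ p⊆p∪q ⁅ y ⁆))
        zx≡0 : lookup z x ≡ 0#
        zx≡0 = trans (Vecₚ.lookup∘update′ x≢y (𝐰 X [ x ]≔ 0#) (t y)) (Vecₚ.lookup∘update x (𝐰 X) 0#)
        zy≡t : lookup z y ≡ t y
        zy≡t = Vecₚ.lookup∘update y (𝐰 X [ x ]≔ 0#) (t y)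
        z⊆swap : supp z ⊆ swap X x y
        z⊆swap = ≡0⇒supp⊆ zero-off-swap
          where
          zero-off-swap : ∀ j → j ∉ swap X x y → lookup z j ≡ 0#
          zero-off-swap j j∉ with j Finₚ.≟ x
          ... | yes refl = zx≡0
          ... | no j≢x = trans (z≡w j j∉⁅x⁆∪⁅y⁆) (w≡0 λ j∈X → j∉ (∈-swap⁺ j∈X j≢x))
            where
            j∉⁅x⁆∪⁅y⁆ : j ∉ ⁅ x ⁆ ∪ ⁅ y ⁆
            j∉⁅x⁆∪⁅y⁆ j∈ with z∈p∪⁅x⁆⁻ j∈
            ... | inj₁ j∈⁅x⁆ = j≢x (x∈⁅y⁆⇒x≡y x j∈⁅x⁆)
            ... | inj₂ refl  = j∉ (y∈swap X x y)
        q = quadratic (∇u (𝐰 X)) M (𝐰 X) z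
        qx≡ : q x ≡ - (M * (w x * w x))
        qx≡ = trans (cong₂ (λ b γ → 2# * (γ * (b - w x)) - M * ((b - w x) * (b - w x))) zx≡0 (g≡0 x∈X))
          (solve 2 (λ M w → :2 :* (:0 :* (:0 :- w)) :- M :* ((:0 :- w) :* (:0 :- w)) := :- (M :* (w :* w)))
              refl M (w x))
        qy≡ : q y ≡ g y * t y
        qy≡ = begin
          q y                                               ≡⟨ cong₂ (λ b a → 2# * (g y * (b - a)) - M * ((b - a) * (b - a))) zy≡t (w≡0 y∉X) ⟩
          2# * (g y * (t y - 0#)) - M * ((t y - 0#) * (t y - 0#))
            ≡⟨ solve 3 (λ g t M → :2 :* (g :* (t :- :0)) :- M :* ((t :- :0) :* (t :- :0))
                  := :2 :* (g :* t) :- M :* t :* t)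
                refl (g y) (t y) M ⟩
          2# * (g y * t y) - M * t y * t y                  ≡⟨ cong (λ γ → 2# * (g y * t y) - γ * t y) (Mt≡g y) ⟩
          2# * (g y * t y) - g y * t y                      ≡⟨ solve 1 (λ a → :2 :* a :- a := a) refl (g y * t y) ⟩
          g y * t y                                         ∎
          where open ≡-Reasoning
        value : weight (⁅ x ⁆ ∪ ⁅ y ⁆) q ≡ score x y
        value = begin
          weight (⁅ x ⁆ ∪ ⁅ y ⁆) q          ≡⟨ weight-∪⁅⁆ q y∉⁅x⁆ ⟩
          weight ⁅ x ⁆ q + q y              ≡⟨ cong (_+ q y) (weight-⁅⁆ x q) ⟩
          q x + q y                         ≡⟨ cong₂ _+_ qx≡ qy≡ ⟩
          - (M * (w x * w x)) + g y * t y   ≡⟨ +-comm _ _ ⟩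
          score x y                         ∎
          where open ≡-Reasoning

      sum-w² : ℝ
      sum-w² = sum (λ i → w i * w i)

      -- Strong concavity is applied from `𝐰 X` towards the origin. The linear term vanishes in
      -- every coordinate, since g is zero on X and w is zero off X, and u 𝟎 ≥ 0 removes the value
      -- at the origin.
      m*sum-w²≤2f : m * sum-w² ≤ 2# * f X
      m*sum-w²≤2f = ≤-by (+-nonNeg (≤⇒0≤- bound) (*-nonNeg (fromℕ-nonNeg 2) 0≤u𝟎))
          (solve 4 (λ m W f u₀ → (:- m :* W :- :2 :* (u₀ :- f)) :+ :2 :* u₀ := :2 :* f :- m :* W)
              refl m sum-w² (f X) (u 𝟎))
        where
        pointwise : ∀ i → quadratic (∇u (𝐰 X)) m (𝐰 X) 𝟎 i ≡ - m * (w i * w i)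
        pointwise i with i ∈? X
        ... | yes i∈X = trans (cong₂ (λ b γ → 2# * (γ * (b - w i)) - m * ((b - w i) * (b - w i))) (lookup-𝟎 i) (g≡0 i∈X))
          (solve 2 (λ m w → :2 :* (:0 :* (:0 :- w)) :- m :* ((:0 :- w) :* (:0 :- w)) := :- m :* (w :* w))
              refl m (w i))
        ... | no i∉X = trans (cong₂ (λ b a → 2# * (g i * (b - a)) - m * ((b - a) * (b - a))) (lookup-𝟎 i) (w≡0 i∉X))
          (trans (solve 2 (λ m g → :2 :* (g :* (:0 :- :0)) :- m :* ((:0 :- :0) :* (:0 :- :0))
                := :- m :* (:0 :* :0))
              refl m (g i))
            (cong (λ a → - m * (a * a)) (sym (w≡0 i∉X))))
        bound : 2# * (u 𝟎 - f X) ≤ - m * sum-w²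
        bound = subst (2# * (u 𝟎 - f X) ≤_)
          (trans (sum-cong-≗ pointwise) (sym (*-distribˡ-sum (- m) (λ i → w i * w i))))
          (concave-on ∣X∣≤s ∣X∣≤s w⊆X (supp-𝟎⊆ {X = X}))

      module _ (G : ℝ) (0≤G : 0# ≤ G) where

        -- The weights for which X is locally optimal when no swap scores above 2 G.
        ω : Fin n → ℝ
        ω i = if lookup X i then M * (w i * w i) else g i * t i - 2# * G

        private
          ∉⇒lookup≡outside : ∀ {i} {p : Subset n} → i ∉ p → lookup p i ≡ outside
          ∉⇒lookup≡outside {i} {p} i∉p with lookup p i in eq
          ... | inside  = ⊥-elim (i∉p (Vecₚ.lookup⇒[]= i p eq))
          ... | outside = refl

          ω-in : ∀ {i} → i ∈ X → ω i ≡ M * (w i * w i)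
          ω-in {i} i∈X = cong (if_then M * (w i * w i) else (g i * t i - 2# * G)) (Vecₚ.[]=⇒lookup i∈X)

          ω-out : ∀ {i} → i ∉ X → ω i ≡ g i * t i - 2# * G
          ω-out {i} i∉X = cong (if_then M * (w i * w i) else (g i * t i - 2# * G)) (∉⇒lookup≡outside i∉X)

          restrict-in : ∀ {p : Subset n} {i} (h : Fin n → ℝ) → i ∈ p → restrict p h i ≡ h i
          restrict-in {i = i} h i∈p = cong (if_then h i else 0#) (Vecₚ.[]=⇒lookup i∈p)

          restrict-out : ∀ {p : Subset n} {i} (h : Fin n → ℝ) → i ∉ p → restrict p h i ≡ 0#
          restrict-out {i = i} h i∉p = cong (if_then h i else 0#) (∉⇒lookup≡outside i∉p)

        ω-locally-optimal : ∀ {x y} → x ∈ X → y ∉ X → score x y ≤ 2# * G → ω y ≤ ω x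
        ω-locally-optimal {x} {y} x∈X y∉X score≤2G = subst₂ _≤_ (sym (ω-out y∉X)) (sym (ω-in x∈X))
          (≤-by (≤⇒0≤- score≤2G)
            (solve 3 (λ a b c → b :- (a :- c) := c :- (a :- b)) refl (g y * t y) (2# * G) (M * (w x * w x))))

        module _ {Y : Subset n} {v : ℝ^ n} (v⊆Y : supp v ⊆ Y) {q} (M≡qm : M ≡ q * m) (0≤q : 0# ≤ q)
                 (0≤qM-m : 0# ≤ q * M - m) where

          -- The constant 2G on Y cancels the shift in `ω` on the part of Y outside X and is mere
          -- slack on X ∩ Y. Charging it on all of Y makes its sum exactly 2G times the size of Y.
          quadratic-bound : Fin n → ℝ
          quadratic-bound i = q * ((restrict Y ω i + restrict Y (const (2# * G)) i) - restrict X ω i)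
                              + (q * M - m) * (w i * w i)

          quadratic≤ : ∀ i → quadratic (∇u (𝐰 X)) m (𝐰 X) v i ≤ quadratic-bound i
          quadratic≤ i with i ∈? X | i ∈? Y
          ... | yes i∈X | yes i∈Y = bounded-both 0≤q (proj₁ 0<m) 0≤qM-m (g≡0 i∈X)
            (trans (restrict-in ω i∈Y) (sym (restrict-in ω i∈X)))
            (subst (0# ≤_) (sym (restrict-in (const (2# * G)) i∈Y)) (*-nonNeg (fromℕ-nonNeg 2) 0≤G))
          ... | yes i∈X | no i∉Y = bounded-X (g≡0 i∈X) (supp⊆⇒≡0 v⊆Y i∉Y) (restrict-out ω i∉Y)
            (restrict-out (const (2# * G)) i∉Y) (trans (restrict-in ω i∈X) (ω-in i∈X))
          ... | no i∉X | yes i∈Y = bounded-Y (proj₁ 0<m) M≡qm (sym (Mt≡g i)) (w≡0 i∉X)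
            (trans (restrict-in ω i∈Y) (trans (ω-out i∉X)
              (cong (λ b → g i * t i - b) (sym (restrict-in (const (2# * G)) i∈Y)))))
            (restrict-out ω i∉X)
          ... | no i∉X | no i∉Y = bounded-neither (w≡0 i∉X) (supp⊆⇒≡0 v⊆Y i∉Y) (restrict-out ω i∉Y)
            (restrict-out (const (2# * G)) i∉Y) (restrict-out ω i∉X)

    module _ (𝓜 : Matroid n) where
      open Matroid 𝓜
      open LocalSearch R 𝓜 using (Swappable)

      -- Z may be smaller than a basis. Only Y takes part in the weight comparison, which suffices
      -- because `𝐰 Z` is supported in Y.
      f-comparison : ∀ {X Y Z q G} (∣X∣≡s : ∣ X ∣ ≡ s) → Indep X → Indep Y → ∣ Y ∣ ≡ s → Z ⊆ Y →
        M ≡ q * m → 1# ≤ q → 0# ≤ G →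
        (∀ x y → Swappable X x y → AtSolution.score X (ℕₚ.≤-reflexive ∣X∣≡s) x y ≤ 2# * G) →
        f Z ≤ q * fromℕ s * G + q * q * f X
      f-comparison {X} {Y} {Z} {q} {G} ∣X∣≡s indX indY ∣Y∣≡s Z⊆Y M≡qm 1≤q 0≤G scores≤ =
        combine-bounds {q = q} {m} {M} {f X} {f Z} {G} {fromℕ s} {weight X (ω G 0≤G)} {weight Y (ω G 0≤G)} {sum-w²}
          M≡qm 0≤q 0≤q²-1 growth
          (local⇒global 𝓜 (ω G 0≤G) indX
            (λ x∈X y∉X ind → ω-locally-optimal G 0≤G x∈X y∉X (scores≤ _ _ (x∈X , y∉X , ind)))
            indY (trans ∣X∣≡s (sym ∣Y∣≡s)))
          m*sum-w²≤2f
        where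
        ∣X∣≤s = ℕₚ.≤-reflexive ∣X∣≡s
        open AtSolution X ∣X∣≤s
        0≤q = ≤-trans 0≤1 1≤q
        0≤q²-1 : 0# ≤ q * q - 1#
        0≤q²-1 = ≤⇒0≤- (subst (_≤ q * q) (*-identityʳ 1#) (*-mono-≤ 0≤1 0≤1 1≤q 1≤q))
        0≤qM-m : 0# ≤ q * M - m
        0≤qM-m = subst (0# ≤_)
          (trans (solve 2 (λ q m → (q :* q :- :1) :* m := q :* (q :* m) :- m)
              refl q m) (cong (λ z → q * z - m) (sym M≡qm)))
          (*-nonNeg 0≤q²-1 (proj₁ 0<m))
        Z⊆ : supp (𝐰 Z) ⊆ Y
        Z⊆ = Z⊆Y ∘ proj₁ (proj₂ (attained Z))
        growth : 2# * (f Z - f X)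
          ≤ q * ((weight Y (ω G 0≤G) + fromℕ s * (2# * G)) - weight X (ω G 0≤G)) + (q * M - m) * sum-w²
        growth = ≤-trans (concave-on ∣X∣≤s (ℕₚ.≤-reflexive ∣Y∣≡s) w⊆X Z⊆)
          (≤-trans (sum-mono-≤ (quadratic≤ G 0≤G {v = 𝐰 Z} Z⊆ M≡qm 0≤q 0≤qM-m))
            (≤-reflexive (trans
              (sum-linear q (q * M - m) (restrict Y (ω G 0≤G)) (restrict Y (const (2# * G))) (restrict X (ω G 0≤G)) (λ i → w i * w i))
              (cong (λ c → q * ((weight Y (ω G 0≤G) + c) - weight X (ω G 0≤G)) + (q * M - m) * sum-w²)
                (trans (weight-const Y (2# * G)) (cong (λ k → fromℕ k * (2# * G)) ∣Y∣≡s))))))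

-- Convergence of the two local search rules

module LocalSearchAnalysis (R : Reals) {n} (𝓜 : Matroid n) where
  open Reals R
  open OrderedFieldProperties orderedField
  open Analysis R
  open Exponential R
  open ExponentialProperties R
  open Localizability R hiding (0≤f)
  open Matroid 𝓜
  open MatroidProperties 𝓜
  open LocalSearch R 𝓜

  Grown⇒Indep : ∀ {X} → Grown X → Indep X
  Grown⇒Indep empty           = indep-⊥
  Grown⇒Indep (add _ _ _ ind) = ind

  Initial⇒∣∣≡rank : ∀ {s X} → IsRank s → Initial X → ∣ X ∣ ≡ s
  Initial⇒∣∣≡rank {s} {X} ((B , indB , ∣B∣≡s) , ≤s) (grown , maximal)
    with ℕₚ.m≤n⇒m<n∨m≡n (≤s X (Grown⇒Indep grown))
  ... | inj₂ ∣X∣≡s = ∣X∣≡s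
  ... | inj₁ ∣X∣<s with augmentation (Grown⇒Indep grown) indB (subst (∣ X ∣ ℕ.<_) (sym ∣B∣≡s) ∣X∣<s)
  ...   | y , _ , y∉X , ind = ⊥-elim (maximal y y∉X ind)

  extend-to-basis : ∀ {s Z} → IsRank s → Indep Z → ∃ λ Y → Indep Y × Z ⊆ Y × ∣ Y ∣ ≡ s
  extend-to-basis {s} {Z} ((B , indB , ∣B∣≡s) , ≤s) indZ
    with augment-to-size (s ℕ.∸ ∣ Z ∣) indZ indB (trans (ℕₚ.m+[n∸m]≡n (≤s Z indZ)) (sym ∣B∣≡s))
  ... | Y , indY , Z⊆Y , _ , ∣Y∣≡∣B∣ = Y , indY , Z⊆Y , trans ∣Y∣≡∣B∣ ∣B∣≡s

  module _ {s} (rank : IsRank s) (1≤s : 1 ≤ℕ s) (u : ℝ^ n → ℝ) (∇u : ℝ^ n → ℝ^ n) (0≤u𝟎 : 0# ≤ u 𝟎)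
           {m M} (0<m : 0# < m) (0<M : 0# < M)
           (concave : RestrictedStronglyConcave u ∇u (Ω₁ (2 *ℕ s)) m)
           (smooth : RestrictedSmooth u ∇u (Ω₂ s 2) M)
           (attained : MaximaAttained u) where
    open Maxima attained

    private
      0≤f = Localizability.0≤f R 1≤s u ∇u 0≤u𝟎 0<m 0<M concave smooth attained
      module Solution X (∣X∣≡s : ∣ X ∣ ≡ s) =
        AtSolution 1≤s u ∇u 0≤u𝟎 0<m 0<M concave smooth attained X (ℕₚ.≤-reflexive ∣X∣≡s)

    -- This is the interface that lets both rules share one convergence proof: `dominates` feeds the
    -- comparison with G equal to the gain, and `achieved` converts that gain into progress of f.
    record Sound (rule : Rule) : Set where
      open Rule rule
      field
        swappable : ∀ {X x y} → Choice X x y → Swappable X x y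
        dominates : ∀ {X x y} (∣X∣≡s : ∣ X ∣ ≡ s) → Choice X x y →
          ∀ x′ y′ → Swappable X x′ y′ → Solution.score X ∣X∣≡s x′ y′ ≤ 2# * gain X x y
        achieved  : ∀ {X x y} → ∣ X ∣ ≡ s → Choice X x y → gain X x y ≤ f (swap X x y) - f X

    -- Among the elements that y′ may replace, φ y′ has the smallest squared coordinate and hence
    -- the largest score. Half that score is at most the increase of f for the pair, which the
    -- chosen pair maximises.
    semiOblivious-sound : Sound (semiOblivious attained)
    semiOblivious-sound = record
      { swappable = λ { (φ , removal , (addable , _) , refl) → proj₁ (removal _ addable) }
      ; dominates = dominates
      ; achieved  = λ _ _ → ≤-refl
      }
      where
      open Rule (semiOblivious attained)
      dominates : ∀ {X x y} (∣X∣≡s : ∣ X ∣ ≡ s) → Choice X x y →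
        ∀ x′ y′ → Swappable X x′ y′ → Solution.score X ∣X∣≡s x′ y′ ≤ 2# * gain X x y
      dominates {X} ∣X∣≡s (φ , removal , (_ , y-max) , refl) x′ y′ sw′ =
        ≤-trans score≤score-φ
          (≤-trans (score≤2gain (proj₁ sw) (proj₁ (proj₂ sw)))
            (*-monoˡ-≤ 2# (fromℕ-nonNeg 2) (y-max y′ (x′ , sw′))))
        where
        open Solution X ∣X∣≡s
        sw = proj₁ (removal y′ (x′ , sw′))
        score≤score-φ : score x′ y′ ≤ score (φ y′) y′
        score≤score-φ = ≤-by
          (*-nonNeg (proj₁ 0<M) (≤⇒0≤- (subst₂ _≤_ (^2≡* _) (^2≡* _) (proj₂ (removal y′ (x′ , sw′)) x′ sw′))))
          (solve 4 (λ M a b c → M :* (b :- a) := (c :- M :* a) :- (c :- M :* b)) refl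
            M (w (φ y′) * w (φ y′)) (w x′ * w x′) (g y′ * t y′))

    -- The gain of this rule is exactly half the score, so `dominates` is its maximality and
    -- `achieved` is `score≤2gain`.
    nonOblivious-sound : Sound (nonOblivious attained ∇u M)
    nonOblivious-sound = record
      { swappable = proj₁
      ; dominates = λ { {X} {x} {y} ∣X∣≡s (_ , max) x′ y′ sw′ →
          subst (_≤ 2# * gain X x y) (2gain≡score ∣X∣≡s x′ y′) (*-monoˡ-≤ 2# (fromℕ-nonNeg 2) (max (x′ , y′) sw′)) }
      ; achieved  = λ { {X} {x} {y} ∣X∣≡s ((x∈X , y∉X , _) , _) → *-cancelˡ-≤ (0<fromℕ-suc 1)
          (subst (_≤ 2# * (f (swap X x y) - f X)) (sym (2gain≡score ∣X∣≡s x y)) (Solution.score≤2gain X ∣X∣≡s x∈X y∉X)) }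
      }
      where
      open Rule (nonOblivious attained ∇u M)
      2≢0 : 2# ≢ 0#
      2≢0 = <⇒≢0 (0<fromℕ-suc 1)
      0<2M : 0# < 2# * M
      0<2M = *-pos (0<fromℕ-suc 1) 0<M
      2gain≡score : ∀ {X} (∣X∣≡s : ∣ X ∣ ≡ s) x y → 2# * gain X x y ≡ Solution.score X ∣X∣≡s x y
      2gain≡score {X} ∣X∣≡s x y = begin
        2# * (c * g y ^ 2 - h * w x ^ 2)
          ≡⟨ cong₂ (λ a b → 2# * (c * a - h * b)) (^2≡* (g y)) (^2≡* (w x)) ⟩
        2# * (c * (g y * g y) - h * (w x * w x))
          ≡⟨ solve 4 (λ c h g w → :2 :* (c :* (g :* g) :- h :* (w :* w))
                := g :* (:2 :* c :* g) :- (:2 :* h) :* (w :* w))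
              refl c h (g y) (w x) ⟩
        g y * (2# * c * g y) - (2# * h) * (w x * w x)
          ≡⟨ cong₂ (λ a b → g y * a - b * (w x * w x)) 2cg≡t (*-/-cancel M 2≢0) ⟩
        g y * t y - M * (w x * w x) ∎
        where
        open ≡-Reasoning
        open Solution X ∣X∣≡s
        c = 1# / (2# * M)
        h = M / 2#
        2cg≡t : 2# * c * g y ≡ t y
        2cg≡t = *-cancelˡ-≡ (<⇒≢0 0<M) (begin
          M * (2# * c * g y)    ≡⟨ solve 3 (λ M c g → M :* (:2 :* c :* g) := (:2 :* M) :* c :* g) refl M c (g y) ⟩
          (2# * M) * c * g y    ≡⟨ cong (_* g y) (*-/-cancel 1# (<⇒≢0 0<2M)) ⟩
          1# * g y              ≡⟨ *-identityˡ (g y) ⟩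
          g y                   ≡⟨ sym (Mt≡g y) ⟩
          M * t y               ∎)

    localSearch-sound : ∀ {rule} → IsLocalSearch attained ∇u M rule → Sound rule
    localSearch-sound isSemiOblivious = semiOblivious-sound
    localSearch-sound isNonOblivious  = nonOblivious-sound

    -- In terms of q, the factor p is 1/q² and a is q/s; they are spelled as in the theorem.
    q p a : ℝ
    q = M / m
    p = m ^ 2 / M ^ 2
    a = M / (fromℕ s * m)

    private
      m≢0 = <⇒≢0 0<m
      M≢0 = <⇒≢0 0<M
      0<s = fromℕ-pos 1≤s
      0<sm = *-pos 0<s 0<m

    M≡qm : M ≡ q * m
    M≡qm = trans (sym (*-/-cancel M m≢0)) (*-comm m q)

    0<M^2 : 0# < M ^ 2
    0<M^2 = subst (0# <_) (sym (^2≡* M)) (*-pos 0<M 0<M)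

    pqq≡1 : p * (q * q) ≡ 1#
    pqq≡1 = *-cancelˡ-≡ (<⇒≢0 (*-pos 0<m 0<m)) (begin
      (m * m) * (p * (q * q))     ≡⟨ solve 3 (λ m p q → (m :* m) :* (p :* (q :* q)) := p :* ((q :* m) :* (q :* m)))
          refl m p q ⟩
      p * ((q * m) * (q * m))     ≡⟨ cong (λ z → p * (z * z)) (sym M≡qm) ⟩
      p * (M * M)                 ≡⟨ cong (p *_) (sym (^2≡* M)) ⟩
      p * M ^ 2                   ≡⟨ *-comm p (M ^ 2) ⟩
      M ^ 2 * p                   ≡⟨ *-/-cancel (m ^ 2) (<⇒≢0 0<M^2) ⟩
      m ^ 2                       ≡⟨ ^2≡* m ⟩
      m * m                       ≡⟨ sym (*-identityʳ (m * m)) ⟩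
      (m * m) * 1#                ∎)
      where open ≡-Reasoning

    as≡q : a * fromℕ s ≡ q
    as≡q = *-cancelˡ-≡ m≢0 (begin
      m * (a * fromℕ s)           ≡⟨ solve 3 (λ m a s → m :* (a :* s) := (s :* m) :* a) refl m a (fromℕ s) ⟩
      (fromℕ s * m) * a           ≡⟨ *-/-cancel M (<⇒≢0 0<sm) ⟩
      M                           ≡⟨ sym (*-/-cancel M m≢0) ⟩
      m * q                       ∎)
      where open ≡-Reasoning

    0≤a : 0# ≤ a
    0≤a = proj₁ (/-pos 0<M 0<sm)

    0≤p : 0# ≤ p
    0≤p = *-nonNeg (subst (0# ≤_) (sym (^2≡* m)) (0≤x*x m)) (proj₁ (⁻¹-pos 0<M^2))

    module _ {Z} (indZ : Indep Z) {rule : Rule} (sound : Sound rule) where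
      open Rule rule
      open Sound sound

      P : ℝ
      P = p * f Z

      -- Scaling by p normalises the coefficient of `f X` to 1, so that `P - f X` becomes the
      -- quantity that contracts.
      comparison : ∀ {X G} (∣X∣≡s : ∣ X ∣ ≡ s) → Indep X → 0# ≤ G →
        (∀ x y → Swappable X x y → Solution.score X ∣X∣≡s x y ≤ 2# * G) →
        P ≤ p * (q * fromℕ s * G) + f X
      comparison {X} {G} ∣X∣≡s indX 0≤G scores≤ with extend-to-basis rank indZ
      ... | Y , indY , Z⊆Y , ∣Y∣≡s = ≤-trans
          (*-monoˡ-≤ p 0≤p (f-comparison 1≤s u ∇u 0≤u𝟎 0<m 0<M concave smooth attained 𝓜
            ∣X∣≡s indX indY ∣Y∣≡s Z⊆Y M≡qm 1≤q 0≤G scores≤))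
          (≤-reflexive (begin
            p * (q * fromℕ s * G + q * q * f X)      ≡⟨ solve 4 (λ p q b f → p :* (b :+ q :* q :* f)
                  := p :* b :+ p :* (q :* q) :* f)
                refl p q (q * fromℕ s * G) (f X) ⟩
            p * (q * fromℕ s * G) + p * (q * q) * f X ≡⟨ cong (λ z → p * (q * fromℕ s * G) + z * f X) pqq≡1 ⟩
            p * (q * fromℕ s * G) + 1# * f X          ≡⟨ cong (p * (q * fromℕ s * G) +_) (*-identityˡ (f X)) ⟩
            p * (q * fromℕ s * G) + f X               ∎))
        where
        open ≡-Reasoning
        -- A basis of size s ≥ 1 has an element, and this is the coordinate along which `m≤M`
        -- compares the curvatures.
        i : ∃ λ i → i ∈ Y
        i with nonempty? Y
        ... | yes found = found
        ... | no none   = ⊥-elim (ℕₚ.<⇒≢ 1≤s (trans (sym (trans (cong ∣_∣ (Empty-unique none)) (∣⊥∣≡0 n))) ∣Y∣≡s))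
        1≤q : 1# ≤ q
        1≤q = *-cancelˡ-≤ 0<m (subst₂ _≤_ (sym (*-identityʳ m)) (sym (*-/-cancel M m≢0))
          (m≤M 1≤s u ∇u 0≤u𝟎 0<m 0<M concave smooth attained (proj₁ i)))

      stopped : ∀ {X} → ∣ X ∣ ≡ s → Indep X → Stops X → P ≤ f X
      stopped {X} ∣X∣≡s indX stops = subst (P ≤_) (solve 3 (λ p c f → p :* (c :* :0) :+ f := f)
          refl p (q * fromℕ s) (f X))
        -- The comparison is used with G = 0: either there is no admissible swap, or a selected pair
        -- of nonpositive gain bounds all scores.
        (comparison ∣X∣≡s indX ≤-refl (scores≤0 stops))
        where
        scores≤0 : Stops X → ∀ x y → Swappable X x y → Solution.score X ∣X∣≡s x y ≤ 2# * 0#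
        scores≤0 (inj₁ none) x y sw = ⊥-elim (none x y sw)
        scores≤0 (inj₂ (x₀ , y₀ , choice , 0≮gain)) x y sw = ≤-trans (dominates ∣X∣≡s choice x y sw)
          (*-monoˡ-≤ 2# (fromℕ-nonNeg 2) gain≤0)
          where
          gain≤0 : gain X x₀ y₀ ≤ 0#
          gain≤0 with gain X x₀ y₀ ≤? 0#
          ... | yes gain≤0 = gain≤0
          ... | no gain≰0  = ⊥-elim (0≮gain (≰⇒> gain≰0))

      -- Since a p q s = p q² = 1, multiplying the comparison by a gives a (P - f X) ≤ gain, and the
      -- gain is at most the increase of f.
      gap-contracts : ∀ {X x y} → ∣ X ∣ ≡ s → Indep X → Choice X x y → 0# < gain X x y →
        P - f (swap X x y) ≤ (1# - a) * (P - f X)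
      gap-contracts {X} {x} {y} ∣X∣≡s indX choice 0<gain =
        ≤-by (+-nonNeg (*-nonNeg 0≤a (≤⇒0≤- bound)) (≤⇒0≤- (achieved ∣X∣≡s choice))) (begin
          a * ((p * (q * S * G) + F) - P) + ((F′ - F) - G)
            ≡⟨ solve 8 (λ a p q S G F P F′ → a :* ((p :* (q :* S :* G) :+ F) :- P) :+ ((F′ :- F) :- G)
                 := p :* (q :* (a :* S)) :* G :- G :+ (((:1 :- a) :* (P :- F)) :- (P :- F′)))
                     refl a p q S G F P F′ ⟩
          p * (q * (a * S)) * G - G + ((1# - a) * (P - F) - (P - F′))
            ≡⟨ cong (λ z → p * (q * z) * G - G + ((1# - a) * (P - F) - (P - F′))) as≡q ⟩
          p * (q * q) * G - G + ((1# - a) * (P - F) - (P - F′))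
            ≡⟨ cong (λ z → z * G - G + ((1# - a) * (P - F) - (P - F′))) pqq≡1 ⟩
          1# * G - G + ((1# - a) * (P - F) - (P - F′))
            ≡⟨ solve 2 (λ G e → :1 :* G :- G :+ e := e) refl G ((1# - a) * (P - F) - (P - F′)) ⟩
          (1# - a) * (P - F) - (P - F′) ∎)
        where
        open ≡-Reasoning
        S = fromℕ s
        G = gain X x y
        F = f X
        F′ = f (swap X x y)
        bound = comparison ∣X∣≡s indX (proj₁ 0<gain) (dominates ∣X∣≡s choice)

      run-noImprovement : ∀ {T X Y} → ∣ X ∣ ≡ s → Indep X → Run T X Y noImprovement → P ≤ f Y
      run-noImprovement ∣X∣≡s indX (stop stops) = stopped ∣X∣≡s indX stops
      run-noImprovement ∣X∣≡s indX (step choice _ run) with swappable choice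
      ... | x∈X , y∉X , ind = run-noImprovement (trans (∣swap∣≡∣X∣ x∈X y∉X) ∣X∣≡s) ind run

      module _ {r} (0≤r : 0# ≤ r) (1-a≤r : 1# - a ≤ r) where

        -- If a > 1 the contraction factor 1 - a is useless for negative gaps, but those stay
        -- negative because f increases.
        gap-step : ∀ {X x y D} → ∣ X ∣ ≡ s → Indep X → Choice X x y → 0# < gain X x y →
          0# ≤ D → P - f X ≤ D → P - f (swap X x y) ≤ r * D
        gap-step {X} {x} {y} {D} ∣X∣≡s indX choice 0<gain 0≤D gap≤D with total 0# (P - f X)
        ... | inj₁ 0≤gap = ≤-trans (gap-contracts ∣X∣≡s indX choice 0<gain)
          (≤-trans (subst₂ _≤_ (*-comm _ _) (*-comm _ _) (*-monoˡ-≤ (P - f X) 0≤gap 1-a≤r)) (*-monoˡ-≤ r 0≤r gap≤D))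
        ... | inj₂ gap≤0 = ≤-trans
          (≤-by (≤-trans (proj₁ 0<gain) (achieved ∣X∣≡s choice))
            (solve 3 (λ P F F′ → F′ :- F := (P :- F) :- (P :- F′)) refl P (f X) (f (swap X x y))))
          (≤-trans gap≤0 (*-nonNeg 0≤r 0≤D))

        -- The majorant D of the current gap is left free, so that one step replaces it by r D. A
        -- run that stops early ends with a nonpositive gap, which is why the full budget T may
        -- still stand in the exponent.
        run-gap : ∀ {T X Y e D} → ∣ X ∣ ≡ s → Indep X → Run T X Y e →
          0# ≤ D → P - f X ≤ D → P - f Y ≤ r ^ T * D
        run-gap {D = D} _ _ done 0≤D gap≤D = ≤-trans gap≤D (≤-reflexive (sym (*-identityˡ D)))
        run-gap {T} {X} {D = D} ∣X∣≡s indX (stop stops) 0≤D _ = ≤-trans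
          (≤-by (≤⇒0≤- (stopped ∣X∣≡s indX stops)) (solve 2 (λ P F → F :- P := :0 :- (P :- F)) refl P (f X)))
          (*-nonNeg (^-nonNeg T 0≤r) 0≤D)
        run-gap {suc T} {D = D} ∣X∣≡s indX (step choice 0<gain run) 0≤D gap≤D with swappable choice
        ... | x∈X , y∉X , ind = ≤-trans
          (run-gap (trans (∣swap∣≡∣X∣ x∈X y∉X) ∣X∣≡s) ind run (*-nonNeg 0≤r 0≤D)
            (gap-step ∣X∣≡s indX choice 0<gain 0≤D gap≤D))
          (≤-reflexive (solve 3 (λ c r D → c :* (r :* D) := r :* c :* D) refl (r ^ T) r D))

      output-noImprovement : ∀ {T X} → Output T X noImprovement → P ≤ f X
      output-noImprovement (_ , initial , run) =
        run-noImprovement (Initial⇒∣∣≡rank rank initial) (Grown⇒Indep (proj₁ initial)) run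

      output-rate : ∀ {T X e} → Output T X e →
        p * (1# - exp (- ((M * fromℕ T) / (fromℕ s * m)))) * f Z ≤ f X
      output-rate {T} {X} (X₀ , initial , run) with exp-dominated-ratio 0≤a
      ... | r , 0≤r , 1-a≤r , powers≤exp =
        ≤-by (≤⇒0≤- (≤-trans gap≤r^TP r^TP≤EP))
          (solve 4 (λ p E F* F → E :* (p :* F*) :- (p :* F* :- F) := F :- p :* (:1 :- E) :* F*)
              refl p E (f Z) (f X))
        where
        E = exp (- ((M * fromℕ T) / (fromℕ s * m)))
        0≤P : 0# ≤ P
        0≤P = *-nonNeg 0≤p (0≤f Z)
        gap≤r^TP : P - f X ≤ r ^ T * P
        gap≤r^TP = run-gap 0≤r 1-a≤r (Initial⇒∣∣≡rank rank initial) (Grown⇒Indep (proj₁ initial)) run 0≤P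
          -- The initial majorant is D = P, because f X₀ ≥ 0.
          (≤-by (0≤f X₀) (solve 2 (λ P F → F := P :- (P :- F)) refl P (f X₀)))
        aT≡ : a * fromℕ T ≡ (M * fromℕ T) / (fromℕ s * m)
        aT≡ = solve 3 (λ M i T → M :* i :* T := M :* T :* i) refl M ((fromℕ s * m) ⁻¹) (fromℕ T)
        r^TP≤EP : r ^ T * P ≤ E * P
        r^TP≤EP = subst₂ _≤_ (*-comm P (r ^ T)) (*-comm P E)
          (*-monoˡ-≤ P 0≤P (subst (λ z → r ^ T ≤ exp (- z)) aT≡ (powers≤exp T)))

theorem13 :
    (R : Reals) →
    let open Reals R
        open Exponential R
        open Analysis R
    in
    (n : ℕ) (𝓜 : Matroid n) →
    let open Matroid 𝓜
        open LocalSearch R 𝓜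
    in
    (s : ℕ) → IsRank s → 1 ≤ℕ s →
    (u : ℝ^ n → ℝ) (∇u : ℝ^ n → ℝ^ n) → IsC¹WithGradient u ∇u → 0# ≤ u 𝟎 →
    (m M : ℝ) → 0# < m → 0# < M →
    RestrictedStronglyConcave u ∇u (Ω₁ (2 *ℕ s)) m →
    RestrictedSmooth u ∇u (Ω₂ s 2) M →
    (attained : MaximaAttained u) →
    let open Maxima attained in
    (X* : Subset n) → IsArgMax f Indep X* →
    (rule : Rule) → IsLocalSearch attained ∇u M rule →
    let open Rule rule in
    ((T : ℕ) (X : Subset n) (ending : Ending) → Output T X ending →
      (m ^ 2 / M ^ 2) * (1# - exp (- ((M * fromℕ T) / (fromℕ s * m)))) * f X* ≤ f X)
    ×
    ((T : ℕ) (X : Subset n) → Output T X noImprovement →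
      (m ^ 2 / M ^ 2) * f X* ≤ f X)
theorem13 R n 𝓜 s rank 1≤s u ∇u _ 0≤u𝟎 m M 0<m 0<M concave smooth attained X* (indX* , _) rule isLocalSearch =
    (λ T X ending → output-rate rank 1≤s u ∇u 0≤u𝟎 0<m 0<M concave smooth attained indX* sound)
  , (λ T X → output-noImprovement rank 1≤s u ∇u 0≤u𝟎 0<m 0<M concave smooth attained indX* sound)
  where
  open LocalSearchAnalysis R 𝓜
  sound = localSearch-sound rank 1≤s u ∇u 0≤u𝟎 0<m 0<M concave smooth attained isLocalSearch
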